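{- Let $t\in\{1,2,3\}$ and let $G$ be a simple connected $t$-tough graph of order $n$ and size $m$ (i.e., $n$ vertices and $m$ edges). If $$m \geq \binom{n-2t}{2} + 3t^2,$$ then $G$ is pancyclic or bipartite, provided that 1) $t=1$ and $n\ge 7$; or 2) $t=2$ and $n\ge 16$; or 3) $t=3$ and $n\ge 28$.
   Context: All graphs are finite, simple and undirected. For a graph $G$, $c(G)$ denotes the number of connected components of $G$. A vertex cutset of a connected graph $G$ is a set $S\subseteq V(G)$ such that $G-S$ (the subgraph induced by $V(G)\setminus S$) is disconnected, i.e. $c(G-S)\ge 2$. For a real number $t$, $G$ is called $t$-tough if $t\cdot c(G-S)\le |S|$ for every vertex cutset $S$ of $G$ (so complete graphs, having no vertex cutset, are $t$-tough for every $t$). A graph of order $n$ is pancyclic if it contains a (simple) cycle of every length $\ell$ with $3\le \ell\le n$. -}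

module Defs where

open import Data.Nat using (ℕ; zero; suc; _+_; _*_; _<ᵇ_)
open import Data.Bool using (Bool; true; false; _∧_; _∨_; not; if_then_else_)
open import Data.Fin using (Fin; zero; suc; toℕ; inject₁; fromℕ; _≟_)
open import Data.Fin.Subset using (Subset; ⊥)
open import Data.Vec using (lookup)
open import Data.Product using (Σ; _×_)
open import Function.Definitions using (Injective)
open import Relation.Binary.PropositionalEquality using (_≡_; _≢_)
open import Relation.Nullary.Decidable using (⌊_⌋)

record Graph (n : ℕ) : Set where
  field
    adj    : Fin n → Fin n → Bool
    sym    : ∀ i j → adj i j ≡ adj j i
    irrefl : ∀ i → adj i i ≡ false
open Graph public

count : ∀ {n} → (Fin n → Bool) → ℕ
count {zero}  f = 0
count {suc n} f = (if f zero then 1 else 0) + count (λ i → f (suc i))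

anyFin : ∀ {n} → (Fin n → Bool) → Bool
anyFin {zero}  f = false
anyFin {suc n} f = f zero ∨ anyFin (λ i → f (suc i))

sumFin : ∀ {n} → (Fin n → ℕ) → ℕ
sumFin {zero}  f = 0
sumFin {suc n} f = f zero + sumFin (λ i → f (suc i))

size : ∀ {n} → Graph n → ℕ
size G = sumFin (λ i → count (λ j → (toℕ i <ᵇ toℕ j) ∧ adj G i j))

reachB : ∀ {n} → Graph n → Subset n → ℕ → Fin n → Fin n → Bool
reachB G S zero    u v = not (lookup S u) ∧ ⌊ u ≟ v ⌋
reachB G S (suc k) u v =
  reachB G S k u v ∨
  (not (lookup S v) ∧ anyFin (λ w → reachB G S k u w ∧ adj G w v))

-- u and v lie in the same connected component of G - S
-- (walks of length ≤ n suffice in a graph on n vertices)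
SameComp : ∀ {n} → Graph n → Subset n → Fin n → Fin n → Bool
SameComp {n} G S u v = reachB G S n u v

-- c(G - S): number of connected components of G - S, counted as the
-- number of vertices outside S that are the least vertex of their component
components : ∀ {n} → Graph n → Subset n → ℕ
components G S =
  count (λ v → not (lookup S v) ∧ not (anyFin (λ u → (toℕ u <ᵇ toℕ v) ∧ SameComp G S u v)))

Connected : ∀ {n} → Graph n → Set
Connected G = ∀ u v → SameComp G ⊥ u v ≡ true

Tough : ∀ {n} → ℕ → Graph n → Set
Tough t G = ∀ S → 2 Data.Nat.≤ components G S → t * components G S Data.Nat.≤ Data.Fin.Subset.∣ S ∣

-- G contains a (simple) cycle of length ℓ (meaningful for ℓ ≥ 3):
-- distinct vertices f 0, …, f (ℓ-1) with f i ~ f (i+1) and f (ℓ-1) ~ f 0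
HasCycle : ∀ {n} → Graph n → ℕ → Set
HasCycle {n} G zero    = Data.Empty.⊥ where import Data.Empty
HasCycle {n} G (suc k) =
  Σ (Fin (suc k) → Fin n) λ f →
    Injective _≡_ _≡_ f ×
    (∀ (i : Fin k) → adj G (f (inject₁ i)) (f (suc i)) ≡ true) ×
    adj G (f (fromℕ k)) (f zero) ≡ true

Pancyclic : ∀ {n} → Graph n → Set
Pancyclic {n} G = ∀ ℓ → 3 Data.Nat.≤ ℓ → ℓ Data.Nat.≤ n → HasCycle G ℓ

Bipartite : ∀ {n} → Graph n → Set
Bipartite {n} G = Σ (Fin n → Bool) λ col → ∀ u v → adj G u v ≡ true → col u ≢ col v

{-# OPTIONS --safe #-}
module Submission where

-- The size bound gives n² < 4m, so by Bondy's argument G is pancyclic as soon as it is Hamiltonian (and the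
-- bipartite alternative never occurs). Suppose G is not Hamiltonian; adding edges preserves all hypotheses, so
-- G may be taken edge-maximal, and then any two non-adjacent vertices are the ends of a Hamiltonian path.
-- Hence non-adjacent vertices have degree sum less than n. Let U be the set of universal vertices, a = |U|,
-- v a vertex of largest degree D outside U, L the set of its e = n - 1 - D non-neighbours and i the largest
-- degree in L. Toughness gives 2t ≤ i and a < i, while i ≤ min(e, D). Bounding the degrees in L, in U and
-- elsewhere by i, n - 1 and D, the size bound leaves an inequality relating t, e, D, i and a (Star below).
-- If e = 2t, then V \ (L ∪ U) is a clique without neighbours in L, so deleting the a < 2t vertices of U
-- disconnects G, against toughness. If e > 2t, a check of finitely many parameters yields n < (t+1)(a+1)
-- or D ≤ a + 1. On a Hamiltonian path from u ∈ L to v, the vertex u and the successors of the universal vertices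
-- form an independent set I of size a + 1: otherwise the path could be rewired into a Hamiltonian cycle.
-- Deleting V \ I now contradicts toughness in the first case, and deleting U does so in the second.

open import Defs renaming (sym to adj-sym)
open import Data.Nat using (ℕ; zero; suc; _+_; _*_; _∸_; _⊓_; _≤_; _<_; z≤n; s≤s; _<ᵇ_; _≤ᵇ_; _≤?_; >-nonZero)
open import Data.Nat.Combinatorics using (_C_; nC1≡n; nCk+nC[k+1]≡[n+1]C[k+1])
open import Data.Nat.Properties
open import Data.Nat.Tactic.RingSolver using (solve-∀)
open import Data.Nat.ListAction using (sum)
open import Data.Nat.ListAction.Properties using (sum-++; sum-↭)
open import Data.Bool using (Bool; T; true; false; _∧_; _∨_; not; if_then_else_)
import Data.Bool.Properties as Bool
open import Data.Fin using (Fin; zero; suc; toℕ; inject₁; fromℕ)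
import Data.Fin as Fin
import Data.Fin.Properties as Fin
open import Data.Fin.Subset using (Subset; ∣_∣)
open import Data.Vec using (lookup; tabulate; _∷_; [])
open import Data.Vec.Properties using (lookup∘tabulate)
open import Data.List using (List; []; _∷_; [_]; _++_; length; map; filter; allFin; take; drop)
import Data.List as List
open import Data.List.Properties
  using (length-map; map-++; ++-assoc; length-++; length-tabulate; take++drop≡id; length-take; length-drop; ∷-injectiveˡ; ∷-injectiveʳ)
open import Data.List.Relation.Unary.All using (All; []; _∷_)
import Data.List.Relation.Unary.All as All
import Data.List.Relation.Unary.All.Properties as All
open import Data.List.Relation.Unary.Any using (here; there)
open import Data.List.Relation.Unary.AllPairs using (AllPairs; []; _∷_)
open import Data.List.Relation.Unary.Unique.Propositional using (Unique)
open import Data.List.Membership.Propositional using (_∈_)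
open import Data.List.Membership.Propositional.Properties using (∈-∃++; ∈-lookup)
open import Data.List.Relation.Binary.Permutation.Propositional
  using (_↭_; ↭-refl; ↭-sym; ↭-trans; ↭-prep; ↭-reflexive; ↭⇒↭ₛ; module PermutationReasoning)
open import Data.List.Relation.Binary.Permutation.Propositional.Properties
  using (map⁺; ↭-length; shift; drop-∷; ∈-resp-↭; ++⁺ˡ; ++⁺ʳ; ++-comm; ++-commutativeMonoid)
open import Data.Product using (∃; ∃₂; _×_; _,_; proj₁; proj₂)
open import Data.Sum using (_⊎_; inj₁; inj₂)
open import Data.Empty using (⊥; ⊥-elim)
open import Function using (_∘_; case_of_)
open import Relation.Nullary using (¬_; Dec; yes; no; contradiction)
open import Relation.Nullary.Decidable using (⌊_⌋; _×-dec_; map′)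
open import Relation.Binary.PropositionalEquality hiding ([_])

-- Booleans and elementary inequalities

ι : Bool → ℕ
ι b = if b then 1 else 0

true≢false : true ≢ false
true≢false ()

≢false⇒true : ∀ {b} → b ≢ false → b ≡ true
≢false⇒true {true}  _ = refl
≢false⇒true {false} p = ⊥-elim (p refl)

≢true⇒false : ∀ {b} → b ≢ true → b ≡ false
≢true⇒false {true}  p = ⊥-elim (p refl)
≢true⇒false {false} _ = refl

∧-true : ∀ {a b} → a ∧ b ≡ true → a ≡ true × b ≡ true
∧-true {true} {true} _ = refl , refl

∧-intro : ∀ {a b} → a ≡ true → b ≡ true → a ∧ b ≡ true
∧-intro refl refl = refl

∨-true : ∀ {a b} → a ∨ b ≡ true → a ≡ true ⊎ b ≡ true
∨-true {true}  _ = inj₁ refl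
∨-true {false} p = inj₂ p

∨-introˡ : ∀ {a b} → a ≡ true → a ∨ b ≡ true
∨-introˡ refl = refl

∨-introʳ : ∀ {a b} → b ≡ true → a ∨ b ≡ true
∨-introʳ {true}  _ = refl
∨-introʳ {false} p = p

not-true : ∀ {b} → not b ≡ true → b ≡ false
not-true {false} _ = refl

≟-refl : ∀ {n} (u : Fin n) → ⌊ u Fin.≟ u ⌋ ≡ true
≟-refl u with u Fin.≟ u
... | yes _ = refl
... | no  p = ⊥-elim (p refl)

≟-true : ∀ {n} {u v : Fin n} → ⌊ u Fin.≟ v ⌋ ≡ true → u ≡ v
≟-true {u = u} {v} p with u Fin.≟ v
... | yes q = q

≟-false : ∀ {n} {u v : Fin n} → u ≢ v → ⌊ u Fin.≟ v ⌋ ≡ false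
≟-false {u = u} {v} p with u Fin.≟ v
... | yes q = ⊥-elim (p q)
... | no  _ = refl

≤-by : ∀ {a b c d} → c ≤ d → a + d ≤ b + c → a ≤ b
≤-by {a} {b} {c} {d} p q = +-cancelʳ-≤ c a b (≤-trans (+-monoʳ-≤ a p) q)

-- Sums and counts over `Fin n`

sumFin-cong : ∀ {n} {f g : Fin n → ℕ} → (∀ i → f i ≡ g i) → sumFin f ≡ sumFin g
sumFin-cong {zero}  h = refl
sumFin-cong {suc n} h = cong₂ _+_ (h zero) (sumFin-cong (h ∘ suc))

sumFin-mono : ∀ {n} {f g : Fin n → ℕ} → (∀ i → f i ≤ g i) → sumFin f ≤ sumFin g
sumFin-mono {zero}  h = z≤n
sumFin-mono {suc n} h = +-mono-≤ (h zero) (sumFin-mono (h ∘ suc))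

sumFin-mono-< : ∀ {n} {f g : Fin n → ℕ} → (∀ i → f i ≤ g i) → ∀ j → f j < g j → sumFin f < sumFin g
sumFin-mono-< h zero    p = +-mono-≤ p (sumFin-mono (h ∘ suc))
sumFin-mono-< {f = f} h (suc j) p =
  ≤-trans (≤-reflexive (sym (+-suc (f zero) _))) (+-mono-≤ (h zero) (sumFin-mono-< (h ∘ suc) j p))

sumFin-+ : ∀ {n} (f g : Fin n → ℕ) → sumFin (λ i → f i + g i) ≡ sumFin f + sumFin g
sumFin-+ {zero}  f g = refl
sumFin-+ {suc n} f g rewrite sumFin-+ (f ∘ suc) (g ∘ suc) =
  interchange (f zero) (g zero) (sumFin (f ∘ suc)) (sumFin (g ∘ suc))
  where
  interchange : ∀ a b c d → a + b + (c + d) ≡ a + c + (b + d)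
  interchange = solve-∀

sumFin-* : ∀ {n} (f : Fin n → ℕ) k → sumFin (λ i → f i * k) ≡ sumFin f * k
sumFin-* {zero}  f k = refl
sumFin-* {suc n} f k rewrite sumFin-* (f ∘ suc) k = sym (*-distribʳ-+ k (f zero) _)

sumFin-const : ∀ n k → sumFin {n} (λ _ → k) ≡ n * k
sumFin-const zero    k = refl
sumFin-const (suc n) k = cong (k +_) (sumFin-const n k)

count≡sum : ∀ {n} (f : Fin n → Bool) → count f ≡ sumFin (ι ∘ f)
count≡sum {zero}  f = refl
count≡sum {suc n} f = cong (ι (f zero) +_) (count≡sum (f ∘ suc))

sumFin≡sum : ∀ {n} (f : Fin n → ℕ) → sumFin f ≡ sum (map f (allFin n))
sumFin≡sum f = go f (λ i → i)
  where
  go : ∀ {n} {A : Set} (f : A → ℕ) (g : Fin n → A) → sumFin (f ∘ g) ≡ sum (map f (List.tabulate g))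
  go {zero}  f g = refl
  go {suc n} f g = cong (f (g zero) +_) (go f (g ∘ suc))

ι-mono : ∀ {a b} → (a ≡ true → b ≡ true) → ι a ≤ ι b
ι-mono {false} h = z≤n
ι-mono {true}  h rewrite h refl = ≤-refl

count-mono : ∀ {n} {f g : Fin n → Bool} → (∀ i → f i ≡ true → g i ≡ true) → count f ≤ count g
count-mono {f = f} {g} h rewrite count≡sum f | count≡sum g = sumFin-mono λ i → ι-mono (h i)

count-mono-< : ∀ {n} {f g : Fin n → Bool} → (∀ i → f i ≡ true → g i ≡ true) →
  ∀ j → f j ≡ false → g j ≡ true → count f < count g
count-mono-< {f = f} {g} h j p q rewrite count≡sum f | count≡sum g =
  sumFin-mono-< (λ i → ι-mono (h i)) j (subst₂ (λ a b → ι a < ι b) (sym p) (sym q) ≤-refl)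

count-cong : ∀ {n} {f g : Fin n → Bool} → (∀ i → f i ≡ g i) → count f ≡ count g
count-cong {f = f} {g} h rewrite count≡sum f | count≡sum g = sumFin-cong λ i → cong ι (h i)

count-zero : ∀ {n} {f : Fin n → Bool} → count f ≡ 0 → ∀ i → f i ≡ false
count-zero {f = f} p i with f i in q
... | false = refl
... | true  = contradiction p (>⇒≢ (≤-<-trans z≤n (count-mono-< {f = λ _ → false} {f} (λ _ ()) i refl q)))

count-not : ∀ {n} (f : Fin n → Bool) → count f + count (not ∘ f) ≡ n
count-not {zero}  f = refl
count-not {suc n} f with f zero
... | true  = cong suc (count-not (f ∘ suc))
... | false = trans (+-suc _ _) (cong suc (count-not (f ∘ suc)))

-- Degrees and the handshake lemma

Σdeg : ∀ {n} → (Fin n → Fin n → Bool) → ℕ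
Σdeg r = sumFin (λ i → count (r i))

-- Induction on `n`: by symmetry the first row and the first column contribute equally, and `zero`
-- is the smaller end of each of its edges.
handshake : ∀ {n} (r : Fin n → Fin n → Bool) → (∀ i j → r i j ≡ r j i) → (∀ i → r i i ≡ false) →
  Σdeg r ≡ 2 * sumFin (λ i → count (λ j → (toℕ i <ᵇ toℕ j) ∧ r i j))
handshake {zero}  r s z = refl
handshake {suc n} r s z = begin
  c + A + sumFin (λ i → ι (r (suc i) zero) + count (λ j → r (suc i) (suc j)))
    ≡⟨ cong₂ _+_ (cong (λ b → ι b + A) (z zero)) (sumFin-+ (λ i → ι (r (suc i) zero)) (λ i → count (λ j → r (suc i) (suc j)))) ⟩
  A + (sumFin (λ i → ι (r (suc i) zero)) + Σdeg (λ i j → r (suc i) (suc j)))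
    ≡⟨ cong (A +_) (cong₂ _+_ column (handshake _ (λ i j → s (suc i) (suc j)) (λ i → z (suc i)))) ⟩
  A + (A + 2 * B)
    ≡⟨ arith A B ⟩
  2 * (A + B) ∎
  where
  open ≡-Reasoning
  c = ι (r zero zero)
  A = count (λ j → r zero (suc j))
  B = sumFin (λ i → count (λ j → (toℕ i <ᵇ toℕ j) ∧ r (suc i) (suc j)))
  column : sumFin (λ i → ι (r (suc i) zero)) ≡ A
  column = trans (sumFin-cong (λ i → cong ι (s (suc i) zero))) (sym (count≡sum (λ j → r zero (suc j))))
  arith : ∀ a b → a + (a + 2 * b) ≡ 2 * (a + b)
  arith = solve-∀

deg : ∀ {n} → Graph n → Fin n → ℕ
deg G x = count (adj G x)

Σdeg≡2size : ∀ {n} (G : Graph n) → Σdeg (adj G) ≡ 2 * size G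
Σdeg≡2size G = handshake (adj G) (adj-sym G) (irrefl G)

-- Adjacency in the complement graph; `codeg` is the degree there.
coadj : ∀ {n} → Graph n → Fin n → Fin n → Bool
coadj G x y = not (adj G x y) ∧ not ⌊ x Fin.≟ y ⌋

codeg : ∀ {n} → Graph n → Fin n → ℕ
codeg G x = count (coadj G x)

coadj-true : ∀ {n} (G : Graph n) {x y} → coadj G x y ≡ true → adj G x y ≡ false × x ≢ y
coadj-true G {x} {y} p with adj G x y | x Fin.≟ y
... | false | no q = refl , q

coadj-intro : ∀ {n} (G : Graph n) {x y} → adj G x y ≡ false → x ≢ y → coadj G x y ≡ true
coadj-intro G {x} {y} p q = ∧-intro (cong not p) (cong not (≟-false q))

coadj-false : ∀ {n} (G : Graph n) {x y} → coadj G x y ≡ false → x ≢ y → adj G x y ≡ true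
coadj-false G {x} {y} p q with adj G x y in r
... | true  = refl
... | false = contradiction (trans (sym p) (cong not (≟-false q))) λ ()

coadj-sym : ∀ {n} (G : Graph n) {x y} → coadj G x y ≡ true → coadj G y x ≡ true
coadj-sym G {x} {y} p with coadj-true G p
... | q , r = coadj-intro G (trans (adj-sym G y x) q) (r ∘ sym)

adj⇒≢ : ∀ {n} (G : Graph n) {x y} → adj G x y ≡ true → x ≢ y
adj⇒≢ G {x} p refl = true≢false (trans (sym p) (irrefl G x))

count-≟ : ∀ {n} (x : Fin n) → count (λ y → ⌊ x Fin.≟ y ⌋) ≡ 1
count-≟ {suc n} zero    = cong suc (trans (count≡sum {n} _) (trans (sumFin-const n 0) (*-zeroʳ n)))
count-≟ {suc n} (suc x) = trans (count-cong lemma) (count-≟ x)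
  where
  lemma : ∀ y → ⌊ suc x Fin.≟ suc y ⌋ ≡ ⌊ x Fin.≟ y ⌋
  lemma y with x Fin.≟ y
  ... | yes _ = refl
  ... | no  _ = refl

deg+codeg : ∀ {n} (G : Graph n) x → deg G x + codeg G x + 1 ≡ n
deg+codeg {n} G x = begin
  deg G x + codeg G x + 1
    ≡⟨ cong₂ _+_ (cong₂ _+_ (count≡sum (adj G x)) (count≡sum (coadj G x)))
                 (trans (sym (count-≟ x)) (count≡sum (λ y → ⌊ x Fin.≟ y ⌋))) ⟩
  sumFin (ι ∘ adj G x) + sumFin (ι ∘ coadj G x) + sumFin (λ y → ι ⌊ x Fin.≟ y ⌋)
    ≡⟨ cong (_+ sumFin (λ y → ι ⌊ x Fin.≟ y ⌋)) (sym (sumFin-+ (ι ∘ adj G x) (ι ∘ coadj G x))) ⟩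
  sumFin (λ y → ι (adj G x y) + ι (coadj G x y)) + sumFin (λ y → ι ⌊ x Fin.≟ y ⌋)
    ≡⟨ sym (sumFin-+ (λ y → ι (adj G x y) + ι (coadj G x y)) (λ y → ι ⌊ x Fin.≟ y ⌋)) ⟩
  sumFin (λ y → ι (adj G x y) + ι (coadj G x y) + ι ⌊ x Fin.≟ y ⌋)
    ≡⟨ sumFin-cong pointwise ⟩
  sumFin {n} (λ _ → 1) ≡⟨ sumFin-const n 1 ⟩
  n * 1 ≡⟨ *-identityʳ n ⟩
  n ∎
  where
  open ≡-Reasoning
  pointwise : ∀ y → ι (adj G x y) + ι (coadj G x y) + ι ⌊ x Fin.≟ y ⌋ ≡ 1
  pointwise y with adj G x y in p | x Fin.≟ y
  ... | true  | yes refl = ⊥-elim (adj⇒≢ G p refl)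
  ... | true  | no _  = refl
  ... | false | yes _ = refl
  ... | false | no _  = refl

-- Extremal vertices and lists of vertices

least : ∀ {n} (P : Fin n → Bool) x → P x ≡ true →
  ∃ λ m → P m ≡ true × (∀ y → (toℕ y <ᵇ toℕ m) ≡ true → P y ≡ false)
least {suc n} P x p with P zero in q
... | true = zero , q , λ y ()
least {suc n} P zero    p | false = contradiction (trans (sym p) q) λ ()
least {suc n} P (suc x) p | false with least (P ∘ suc) x p
... | m , a , b = suc m , a , λ { zero _ → q ; (suc y) r → b y r }

argmax : ∀ {n} (P : Fin n → Bool) (f : Fin n → ℕ) x → P x ≡ true →
  ∃ λ m → P m ≡ true × (∀ y → P y ≡ true → f y ≤ f m)
argmax {suc n} P f x p with Fin.any? (λ y → P (suc y) Bool.≟ true)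
argmax {suc n} P f x p | yes (x′ , p′) with argmax (P ∘ suc) (f ∘ suc) x′ p′
... | m , a , b with P zero in q | f zero ≤? f (suc m)
... | false | _ = suc m , a , λ { zero r → contradiction (trans (sym r) q) λ () ; (suc y) r → b y r }
... | true | yes s = suc m , a , λ { zero _ → s ; (suc y) r → b y r }
... | true | no  s = zero , q , λ { zero _ → ≤-refl ; (suc y) r → ≤-trans (b y r) (<⇒≤ (≰⇒> s)) }
argmax {suc n} P f zero p | no ¬q = zero , p , λ { zero _ → ≤-refl ; (suc y) r → ⊥-elim (¬q (y , r)) }
argmax {suc n} P f (suc x) p | no ¬q = ⊥-elim (¬q (x , p))

unique-length≤count : ∀ {n} (f : Fin n → Bool) xs → Unique xs → All (λ x → f x ≡ true) xs → length xs ≤ count f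
unique-length≤count f [] _ _ = z≤n
unique-length≤count {n} f (x ∷ xs) (x∉xs ∷ u) (p ∷ ps) =
  ≤-<-trans (unique-length≤count f′ xs u (All.zipWith (λ { (a , b) → ∧-intro a (cong not (≟-false b)) }) (ps , x∉xs)))
            (count-mono-< {f = f′} (λ i q → proj₁ (∧-true q)) x (trans (cong (λ b → f x ∧ not b) (≟-refl x)) (Bool.∧-zeroʳ (f x))) p)
  where
  f′ : Fin n → Bool
  f′ y = f y ∧ not ⌊ x Fin.≟ y ⌋

list : ∀ {n} → (Fin n → Bool) → List (Fin n)
list {n} f = filter (λ x → f x Bool.≟ true) (allFin n)

length-list : ∀ {n} (f : Fin n → Bool) → length (list f) ≡ count f
length-list f = go f (λ i → i)
  where
  go : ∀ {n} {A : Set} (f : A → Bool) (g : Fin n → A) →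
    length (filter (λ x → f x Bool.≟ true) (List.tabulate g)) ≡ count (f ∘ g)
  go {zero}  f g = refl
  go {suc n} f g with f (g zero)
  ... | true  = cong suc (go f (g ∘ suc))
  ... | false = go f (g ∘ suc)

∣tabulate∣ : ∀ {n} (f : Fin n → Bool) → ∣ tabulate f ∣ ≡ count f
∣tabulate∣ {zero}  f = refl
∣tabulate∣ {suc n} f with f zero
... | true  = cong suc (∣tabulate∣ (f ∘ suc))
... | false = ∣tabulate∣ (f ∘ suc)

anyFin-true : ∀ {n} {f : Fin n → Bool} → anyFin f ≡ true → ∃ λ i → f i ≡ true
anyFin-true {suc n} p with ∨-true p
... | inj₁ q = zero , q
... | inj₂ q with anyFin-true q
...   | i , r = suc i , r

anyFin-intro : ∀ {n} {f : Fin n → Bool} i → f i ≡ true → anyFin f ≡ true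
anyFin-intro zero    p = ∨-introˡ p
anyFin-intro (suc i) p = ∨-introʳ (anyFin-intro i p)

-- Lower bounds for the number of components, by colourings

module _ {n : ℕ} (G : Graph n) (S : Subset n) {K : Set} (col : Fin n → K)
  (col-adj : ∀ x y → lookup S x ≡ false → lookup S y ≡ false → adj G x y ≡ true → col x ≡ col y) where

  -- A colouring constant along the edges of `G - S` is constant along its walks, by induction on
  -- the length. Distinct colours thus certify distinct components.
  reach-col : ∀ k x y → reachB G S k x y ≡ true → lookup S x ≡ false × lookup S y ≡ false × col x ≡ col y
  reach-col zero x y p with ∧-true p
  ... | a , b with ≟-true {u = x} {y} b
  ...   | refl = not-true a , not-true a , refl
  reach-col (suc k) x y p with ∨-true p
  ... | inj₁ q = reach-col k x y q
  ... | inj₂ q with ∧-true q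
  ...   | a , b with anyFin-true b
  ...     | w , c with ∧-true c
  ...       | d , e with reach-col k x w d
  ...         | f , g , h = f , not-true a , trans h (col-adj w y g (not-true a) e)

-- The least vertex of each colour class is the least vertex of its component, which is what `components` counts.
components-≥ : ∀ {n} (G : Graph n) (S : Subset n) (col : Fin n → Fin n) →
  (∀ x y → lookup S x ≡ false → lookup S y ≡ false → adj G x y ≡ true → col x ≡ col y) →
  ∀ R → Unique R → All (λ r → lookup S r ≡ false × col r ≡ r) R → length R ≤ components G S
components-≥ {n} G S col col-adj R uR aR with leaders R uR aR
  where
  isLeader : Fin n → Bool
  isLeader v = not (lookup S v) ∧ not (anyFin (λ u → (toℕ u <ᵇ toℕ v) ∧ SameComp G S u v))

  leader : ∀ r → lookup S r ≡ false → col r ≡ r → ∃ λ m → isLeader m ≡ true × col m ≡ r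
  leader r p q with least (λ x → not (lookup S x) ∧ ⌊ col x Fin.≟ r ⌋) r
                      (∧-intro (cong not p) (trans (cong (λ c → ⌊ c Fin.≟ r ⌋) q) (≟-refl r)))
  ... | m , a , b with ∧-true a
  ...   | c , d = m , ∧-intro c (cong not (≢true⇒false notAny)) , ≟-true d
    where
    notAny : anyFin (λ u → (toℕ u <ᵇ toℕ m) ∧ SameComp G S u m) ≢ true
    notAny t with anyFin-true t
    ... | u , e with ∧-true e
    ...   | f , g with reach-col G S col col-adj n u m g
    ...     | h , _ , i = true≢false (trans (sym (∧-intro (cong not h)
                (trans (cong (λ c → ⌊ c Fin.≟ r ⌋) (trans i (≟-true d))) (≟-refl r)))) (b u f))

  leaders : ∀ R → Unique R → All (λ r → lookup S r ≡ false × col r ≡ r) R →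
    ∃ λ M → map col M ≡ R × Unique M × All (λ m → isLeader m ≡ true) M
  leaders [] _ _ = [] , refl , [] , []
  leaders (r ∷ R) (a ∷ u) ((p , q) ∷ ps) with leader r p q | leaders R u ps
  ... | m , b , c | M , refl , v , d =
    m ∷ M , cong (_∷ map col M) c ,
    -- Equal leaders have equal colours, so the distinctness of `R` passes to `M`.
    (All.map (λ {x} e f → e (trans (sym c) (cong col f))) (All.map⁻ a) ∷ v) , b ∷ d
... | M , refl , uM , aM = ≤-trans (≤-reflexive (length-map col M)) (unique-length≤count _ M uM aM)


-- Walks and pigeonhole arguments on lists

module _ {A : Set} where

  cnt : (A → Bool) → List A → ℕ
  cnt f xs = sum (map (ι ∘ f) xs)

  cnt-++ : ∀ f xs ys → cnt f (xs ++ ys) ≡ cnt f xs + cnt f ys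
  cnt-++ f xs ys = trans (cong sum (map-++ (ι ∘ f) xs ys)) (sum-++ (map (ι ∘ f) xs) _)

  cnt-↭ : ∀ f {xs ys} → xs ↭ ys → cnt f xs ≡ cnt f ys
  cnt-↭ f p = sum-↭ (map⁺ (ι ∘ f) p)

  -- For two equally long stretches of a Hamiltonian path, a match supplies two chords whose ends
  -- lie at a prescribed distance.
  record Match (p q : A → Bool) (K B : List A) : Set where
    constructor match
    field
      K₁ K₂ B₁ B₂ : List A
      c b : A
      K≡ : K ≡ K₁ ++ c ∷ K₂
      B≡ : B ≡ B₁ ++ b ∷ B₂
      aligned : length K₁ ≡ length B₁
      pc : p c ≡ true
      qb : q b ≡ true

  match-∷ : ∀ {p q c b K B} → Match p q K B → Match p q (c ∷ K) (b ∷ B)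
  match-∷ (match _ _ _ _ _ _ e₁ e₂ e₃ e₄ e₅) = match _ _ _ _ _ _ (cong (_ ∷_) e₁) (cong (_ ∷_) e₂) (cong suc e₃) e₄ e₅

  -- Without a match the positions of `p` in `K` and those of `q` in `B` would be disjoint, so there
  -- would be at most `length K` of them.
  pigeonhole : ∀ p q K B → length K ≡ length B → length K < cnt p K + cnt q B → Match p q K B
  pigeonhole p q [] [] _ ()
  pigeonhole p q (c ∷ K) (b ∷ B) e h with p c in pc | q b in qb
  ... | true  | true  = match [] K [] B c b refl refl refl pc qb
  ... | true  | false = match-∷ (pigeonhole p q K B (suc-injective e) (≤-pred h))
  ... | false | true  = match-∷ (pigeonhole p q K B (suc-injective e) (≤-pred (≤-trans h (≤-reflexive (+-suc _ _)))))
  ... | false | false = match-∷ (pigeonhole p q K B (suc-injective e) (<⇒≤ h))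

  unique-↭ : ∀ {xs ys : List A} → xs ↭ ys → Unique xs → Unique ys
  unique-↭ p = Unique-resp-↭ (↭⇒↭ₛ p)
    where
    open import Data.List.Relation.Binary.Permutation.Setoid.Properties (setoid A) using (Unique-resp-↭)

  unique-++ˡ : ∀ (xs {ys} : List A) → Unique (xs ++ ys) → Unique xs
  unique-++ˡ [] _ = []
  unique-++ˡ (x ∷ xs) (a ∷ u) = All.++⁻ˡ xs a ∷ unique-++ˡ xs u

  -- Compares two splittings of one list: `b` stands `s` places after `c`, and `Z` is the stretch
  -- from `c` up to just before `b`.
  cut : ∀ X {c Y} W {b : A} {V} s → X ++ c ∷ Y ≡ W ++ b ∷ V → length W ≡ length X + s →
    ∃ λ Z → c ∷ Y ≡ Z ++ b ∷ V × length Z ≡ s × W ≡ X ++ Z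
  cut [] W s e l = W , e , l , refl
  cut (x ∷ X) (w ∷ W) s e l with cut X W s (∷-injectiveʳ e) (suc-injective l)
  ... | Z , a , b , c = Z , a , b , cong₂ _∷_ (sym (∷-injectiveˡ e)) c

  -- The vertices of the walk are x ∷ xs.
  Walk : (A → A → Bool) → A → List A → A → Set
  Walk r x []       y = x ≡ y
  Walk r x (z ∷ zs) y = r x z ≡ true × Walk r z zs y

  module _ {r : A → A → Bool} where

    walk-++ : ∀ {x} xs {y z zs w} → Walk r x xs y → r y z ≡ true → Walk r z zs w → Walk r x (xs ++ z ∷ zs) w
    walk-++ []       refl    e v = e , v
    walk-++ (_ ∷ xs) (d , u) e v = d , walk-++ xs u e v

    walk-split : ∀ {x} as {b bs z} → Walk r x (as ++ b ∷ bs) z →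
      ∃ λ a → Walk r x as a × r a b ≡ true × Walk r b bs z
    walk-split []       (e , v) = _ , refl , e , v
    walk-split (_ ∷ as) (d , w) with walk-split as w
    ... | a , u , e , v = a , (d , u) , e , v

    walk-last : ∀ {x} xs {y} → Walk r x xs y → ∃ λ zs → x ∷ xs ≡ zs ++ [ y ]
    walk-last []       refl = [] , refl
    walk-last {x} (_ ∷ xs) (_ , w) with walk-last xs w
    ... | zs , e = x ∷ zs , cong (x ∷_) e

    -- Of the reversed list only the permutation is recorded, which suffices for its length, its
    -- distinctness and its being spanning.
    walk-reverse : (∀ a b → r a b ≡ r b a) → ∀ {x} xs {y} → Walk r x xs y →
      ∃ λ ys → Walk r y ys x × y ∷ ys ↭ x ∷ xs
    walk-reverse s [] refl = [] , refl , ↭-refl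
    walk-reverse s {x} (z ∷ xs) {y} (e , w) with walk-reverse s xs w
    ... | ys , v , p = ys ++ [ x ] , walk-++ ys v (trans (s z x) e) refl ,
      ↭-trans (++-comm (y ∷ ys) [ x ]) (↭-prep x p)

    Crossing : (p q : A → Bool) → A → List A → A → Set
    Crossing p q x xs y = ∃₂ λ as a → ∃₂ λ b bs → xs ≡ as ++ b ∷ bs ×
      Walk r x as a × r a b ≡ true × Walk r b bs y × p a ≡ true × q b ≡ true

    -- Count `p` at the tails and `q` at the heads of the `length xs` steps; more hits than steps
    -- put both on one step. As `p y` is false, the last vertex, which is no tail, adds nothing.
    crossing : ∀ (p q : A → Bool) x xs {y} → Walk r x xs y → p y ≡ false →
      length xs < cnt p (x ∷ xs) + cnt q xs → Crossing p q x xs y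
    crossing p q x [] refl py h rewrite py = ⊥-elim (n≮0 h)
    crossing p q x (z ∷ xs) {y} (e , w) py h = cases (p x) (q z) refl refl h
      where
      extend : Crossing p q z xs y → Crossing p q x (z ∷ xs) y
      extend (as , a , b , bs , i , u , j) = z ∷ as , a , b , bs , cong (z ∷_) i , (e , u) , j
      cases : ∀ α β → p x ≡ α → q z ≡ β →
        suc (length xs) < ι α + cnt p (z ∷ xs) + (ι β + cnt q xs) → Crossing p q x (z ∷ xs) y
      cases true  true  px qz h = [] , x , z , xs , refl , refl , e , w , px , qz
      cases true  false _  _  h = extend (crossing p q z xs w py (≤-pred h))
      cases false true  _  _  h = extend (crossing p q z xs w py (≤-pred (≤-trans h (≤-reflexive (+-suc _ _)))))
      cases false false _  _  h = extend (crossing p q z xs w py (<⇒≤ h))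

    module _ (P : A → Bool) where

      successors : A → List A → List A
      successors x []       = []
      successors x (z ∷ zs) = if P x then z ∷ successors z zs else successors z zs

      -- The last vertex fails `P`, so each vertex satisfying `P` is followed by another one.
      length-successors : ∀ x xs {y} → Walk r x xs y → P y ≡ false → length (successors x xs) ≡ cnt P (x ∷ xs)
      length-successors x [] refl p rewrite p = refl
      length-successors x (z ∷ zs) (_ , w) p with P x
      ... | true  = cong suc (length-successors z zs w p)
      ... | false = length-successors z zs w p

      successors-All : ∀ {Q : A → Set} x zs → All Q zs → All Q (successors x zs)
      successors-All x [] [] = []
      successors-All x (z ∷ zs) (a ∷ as) with P x
      ... | true  = a ∷ successors-All z zs as
      ... | false = successors-All z zs as

      successors-unique : ∀ x zs → Unique zs → Unique (successors x zs)
      successors-unique x [] [] = []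
      successors-unique x (z ∷ zs) (a ∷ as) with P x
      ... | true  = successors-All z zs a ∷ successors-unique z zs as
      ... | false = successors-unique z zs as

      SplitAt : A → List A → A → A → Set
      SplitAt x xs y b = ∃₂ λ as a → ∃ λ bs →
        xs ≡ as ++ b ∷ bs × Walk r x as a × r a b ≡ true × Walk r b bs y × P a ≡ true

      successors-split : ∀ x xs {y} → Walk r x xs y → All (SplitAt x xs y) (successors x xs)
      successors-split x [] w = []
      successors-split x (z ∷ zs) {y} (e , w) with P x in p
      ... | true  = ([] , x , zs , refl , refl , e , w , p) ∷ All.map extend (successors-split z zs w)
        where
        extend : ∀ {b} → SplitAt z zs y b → SplitAt x (z ∷ zs) y b
        extend (as , a , bs , i , u , j) = z ∷ as , a , bs , cong (z ∷_) i , (e , u) , j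
      ... | false = All.map extend (successors-split z zs w)
        where
        extend : ∀ {b} → SplitAt z zs y b → SplitAt x (z ∷ zs) y b
        extend (as , a , bs , i , u , j) = z ∷ as , a , bs , cong (z ∷_) i , (e , u) , j

-- Spanning lists of vertices and deciding Hamiltonicity

cnt-allFin : ∀ {n} (f : Fin n → Bool) {xs} → xs ↭ allFin n → cnt f xs ≡ count f
cnt-allFin f p = trans (cnt-↭ f p) (sym (trans (count≡sum f) (sumFin≡sum (ι ∘ f))))

unique-allFin : ∀ {n} {xs : List (Fin n)} → xs ↭ allFin n → Unique xs
unique-allFin {n} p = unique-↭ (↭-sym p) (allFin⁺ n)
  where open import Data.List.Relation.Unary.Unique.Propositional.Properties using (allFin⁺)

length-allFin : ∀ {n} {xs : List (Fin n)} → xs ↭ allFin n → length xs ≡ n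
length-allFin p = trans (↭-length p) (length-tabulate (λ i → i))

module Perm {A : Set} where
  open import Algebra.Solver.CommutativeMonoid (++-commutativeMonoid {A = A}) public
    using (solve; _⊕_; _⊜_)

module _ {n : ℕ} where

  _↭?_ : ∀ (xs ys : List (Fin n)) → Dec (xs ↭ ys)
  [] ↭? []       = yes ↭-refl
  [] ↭? (y ∷ ys) = no λ p → case ↭-length p of λ ()
  (x ∷ xs) ↭? ys with x ∈? ys
    where open import Data.List.Membership.DecPropositional (Fin._≟_ {n}) using (_∈?_)
  ... | no x∉ys = no λ p → x∉ys (∈-resp-↭ p (here refl))
  ... | yes x∈ys with ∈-∃++ x∈ys
  ...   | as , bs , refl = map′ (λ p → ↭-trans (↭-prep x p) (↭-sym (shift x as bs)))
                                (λ p → drop-∷ (↭-trans p (shift x as bs)))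
                                (xs ↭? (as ++ bs))

  anyList? : ∀ k {Q : List (Fin n) → Set} → (∀ xs → Dec (Q xs)) → Dec (∃ λ xs → length xs ≡ k × Q xs)
  anyList? zero Q? with Q? []
  ... | yes q = yes ([] , refl , q)
  ... | no ¬q = no λ { ([] , _ , q) → ¬q q }
  anyList? (suc k) Q? with Fin.any? (λ x → anyList? k (λ xs → Q? (x ∷ xs)))
  ... | yes (x , xs , l , q) = yes (x ∷ xs , cong suc l , q)
  ... | no ¬q = no λ { (x ∷ xs , l , q) → ¬q (x , xs , suc-injective l , q) }

  Ham : (Fin n → Fin n → Bool) → Set
  Ham r = ∃₂ λ x xs → ∃ λ y → Walk r x xs y × r y x ≡ true × x ∷ xs ↭ allFin n

  -- `o` remembers where the closed walk began while `x` advances.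
  closedWalk? : ∀ (r : Fin n → Fin n → Bool) o x xs → Dec (∃ λ y → Walk r x xs y × r y o ≡ true)
  closedWalk? r o x [] = map′ (λ e → x , refl , e) (λ { (_ , refl , e) → e }) (r x o Bool.≟ true)
  closedWalk? r o x (z ∷ zs) = map′ (λ { (e , y , w , c) → y , (e , w) , c }) (λ { (y , (e , w) , c) → e , y , w , c })
    (r x z Bool.≟ true ×-dec closedWalk? r o z zs)

  -- A finite search through all vertex lists of length `n`; it makes the case distinction behind
  -- edge-maximality constructive.
  ham? : ∀ r → Dec (Ham r)
  ham? r = map′ to from (anyList? n Q?)
    where
    Q : List (Fin n) → Set
    Q []       = ⊥
    Q (x ∷ xs) = (∃ λ y → Walk r x xs y × r y x ≡ true) × x ∷ xs ↭ allFin n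
    Q? : ∀ xs → Dec (Q xs)
    Q? []       = no λ ()
    Q? (x ∷ xs) = closedWalk? r x x xs ×-dec ((x ∷ xs) ↭? allFin n)
    to : ∃ (λ xs → length xs ≡ n × Q xs) → Ham r
    to (x ∷ xs , _ , (y , w , c) , p) = x , xs , y , w , c , p
    from : Ham r → ∃ (λ xs → length xs ≡ n × Q xs)
    from (x , xs , y , w , c , p) = x ∷ xs , length-allFin p , (y , w , c) , p

-- Hamiltonian cycles after the addition of an edge

walk-end-All : ∀ {A : Set} {r : A → A → Bool} {Q : A → Set} {x} xs {y} → Walk r x xs y → All Q (x ∷ xs) → Q y
walk-end-All []       refl    (q ∷ _)  = q
walk-end-All (_ ∷ xs) (_ , w) (_ ∷ qs) = walk-end-All xs w qs

addEdge : ∀ {n} → Graph n → {u v : Fin n} → u ≢ v → Graph n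
addEdge {n} G {u} {v} u≢v = record { adj = adj′ ; sym = sym′ ; irrefl = irrefl′ }
  where
  adj′ : Fin n → Fin n → Bool
  adj′ i j = adj G i j ∨ ((⌊ i Fin.≟ u ⌋ ∧ ⌊ j Fin.≟ v ⌋) ∨ (⌊ i Fin.≟ v ⌋ ∧ ⌊ j Fin.≟ u ⌋))
  sym′ : ∀ i j → adj′ i j ≡ adj′ j i
  sym′ i j = cong₂ _∨_ (adj-sym G i j) (trans (Bool.∨-comm (⌊ i Fin.≟ u ⌋ ∧ ⌊ j Fin.≟ v ⌋) _)
    (cong₂ _∨_ (Bool.∧-comm ⌊ i Fin.≟ v ⌋ _) (Bool.∧-comm ⌊ i Fin.≟ u ⌋ _)))
  irrefl′ : ∀ i → adj′ i i ≡ false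
  irrefl′ i with i Fin.≟ u | i Fin.≟ v
  ... | yes refl | yes refl = ⊥-elim (u≢v refl)
  ... | yes _ | no _  = trans (Bool.∨-identityʳ _) (irrefl G i)
  ... | no _  | yes _ = trans (Bool.∨-identityʳ _) (irrefl G i)
  ... | no _  | no _  = trans (Bool.∨-identityʳ _) (irrefl G i)

HamPath : ∀ {n} → Graph n → Fin n → Fin n → Set
HamPath {n} G u v = ∃ λ xs → Walk (adj G) u xs v × u ∷ xs ↭ allFin n

hamPath-reverse : ∀ {n} (G : Graph n) {u v} → HamPath G u v → HamPath G v u
hamPath-reverse G (xs , w , p) with walk-reverse (adj-sym G) xs w
... | ys , w′ , p′ = ys , w′ , ↭-trans p′ p

module _ {n : ℕ} (G : Graph n) {u v : Fin n} (u≢v : u ≢ v) where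

  private
    G′ = addEdge G u≢v

    New : Fin n → Fin n → Set
    New a b = (a ≡ u × b ≡ v) ⊎ (a ≡ v × b ≡ u)

    old-or-new : ∀ {a b} → adj G′ a b ≡ true → adj G a b ≡ true ⊎ New a b
    old-or-new p with ∨-true p
    ... | inj₁ q = inj₁ q
    ... | inj₂ q with ∨-true q
    ...   | inj₁ r = inj₂ (inj₁ (≟-true (proj₁ (∧-true r)) , ≟-true (proj₂ (∧-true r))))
    ...   | inj₂ r = inj₂ (inj₂ (≟-true (proj₁ (∧-true r)) , ≟-true (proj₂ (∧-true r))))

    -- The new edge contains `q`, so an edge that avoids `q` is old.
    old-edge : ∀ {p q a b} → New p q → q ≢ a → q ≢ b → adj G′ a b ≡ true → adj G a b ≡ true
    old-edge N a≢ b≢ e with old-or-new e | N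
    ... | inj₁ o | _ = o
    ... | inj₂ (inj₁ (refl , refl)) | inj₁ (refl , refl) = ⊥-elim (b≢ refl)
    ... | inj₂ (inj₁ (refl , refl)) | inj₂ (refl , refl) = ⊥-elim (a≢ refl)
    ... | inj₂ (inj₂ (refl , refl)) | inj₁ (refl , refl) = ⊥-elim (a≢ refl)
    ... | inj₂ (inj₂ (refl , refl)) | inj₂ (refl , refl) = ⊥-elim (b≢ refl)

    old-edge′ : ∀ {p q b} → New p q → q ≢ b → p ≢ b → adj G′ q b ≡ true → adj G q b ≡ true
    old-edge′ N q≢ p≢ e with old-or-new e | N
    ... | inj₁ o | _ = o
    ... | inj₂ (inj₁ (refl , refl)) | inj₁ (refl , refl) = ⊥-elim (q≢ refl)
    ... | inj₂ (inj₁ (refl , refl)) | inj₂ (refl , refl) = ⊥-elim (p≢ refl)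
    ... | inj₂ (inj₂ (refl , refl)) | inj₁ (refl , refl) = ⊥-elim (p≢ refl)
    ... | inj₂ (inj₂ (refl , refl)) | inj₂ (refl , refl) = ⊥-elim (q≢ refl)

    old-walk : ∀ {p q} → New p q → ∀ x xs {y} → Walk (adj G′) x xs y → All (q ≢_) (x ∷ xs) → Walk (adj G) x xs y
    old-walk N x []       w       _            = w
    old-walk N x (z ∷ zs) (e , w) (a ∷ b ∷ as) = old-edge N a b e , old-walk N z zs w (b ∷ as)

    -- Only the first step meets `q`, and as the path has at least two steps, this step does not end
    -- in `p`. So no step is the new edge.
    old-path : ∀ {p q} → New p q → ∀ zs → 2 ≤ length zs → Walk (adj G′) q zs p → Unique (q ∷ zs) → Walk (adj G) q zs p
    old-path N (z ∷ z′ ∷ zs) _ (e , w@(_ , w′)) (a ∷ b ∷ _) =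
      old-edge′ N (All.head a) (walk-end-All {Q = λ y → y ≢ z} zs w′ (All.map (λ f g → f (sym g)) b)) e , old-walk N z (z′ ∷ zs) w a
    old-path N (_ ∷ []) (s≤s ())

    find-new : ∀ x xs {y} → Walk (adj G′) x xs y → Walk (adj G) x xs y ⊎
      (∃₂ λ as p → ∃₂ λ q bs → xs ≡ as ++ q ∷ bs × Walk (adj G′) x as p × New p q × Walk (adj G′) q bs y)
    find-new x [] w = inj₁ w
    find-new x (z ∷ zs) (e , w) with old-or-new e
    ... | inj₂ N = inj₂ ([] , x , z , zs , refl , refl , N , w)
    ... | inj₁ o with find-new z zs w
    ...   | inj₁ w′ = inj₁ (o , w′)
    ...   | inj₂ (as , p , q , bs , i , w₁ , N , w₂) = inj₂ (z ∷ as , p , q , bs , cong (z ∷_) i , (e , w₁) , N , w₂)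

    orient : ∀ {p q} → New p q → HamPath G q p → HamPath G u v
    orient (inj₁ (refl , refl)) h = hamPath-reverse G h
    orient (inj₂ (refl , refl)) h = h

  -- A Hamiltonian cycle of `G′` must use the new edge; opened there, it is a path of `G`. For
  -- `n = 2` a single edge traversed back and forth satisfies `Ham`, hence the bound on `n`.
  addEdge-hamPath : 3 ≤ n → ¬ Ham (adj G) → Ham (adj G′) → HamPath G u v
  addEdge-hamPath n≥3 ¬ham (x , xs , y , w , c , p) with find-new x xs w
  ... | inj₁ w′ with old-or-new c
  ...   | inj₁ c′ = ⊥-elim (¬ham (x , xs , y , w′ , c′ , p))
  ...   | inj₂ N  = orient N (xs , w′ , p)
  addEdge-hamPath n≥3 ¬ham (x , .(as ++ q ∷ bs) , y , w , c , p) | inj₂ (as , p₀ , q , bs , refl , w₁ , N , w₂) =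
    orient N (bs ++ x ∷ as ,
      old-path N (bs ++ x ∷ as) (≤-pred (≤-trans n≥3 (≤-reflexive (sym (length-allFin p′))))) (walk-++ bs w₂ c w₁) (unique-allFin p′) , p′)
    where
    p′ : q ∷ bs ++ x ∷ as ↭ allFin n
    p′ = ↭-trans (++-comm (q ∷ bs) (x ∷ as)) p

-- Rewiring Hamiltonian paths into cycles

-- Replacing the edge ab of a Hamiltonian u–v path by av and ub closes it to a cycle.
rotate : ∀ {n} (G : Graph n) {u v a b} as bs → Walk (adj G) u as a → Walk (adj G) b bs v →
  u ∷ as ++ b ∷ bs ↭ allFin n → adj G a v ≡ true → adj G u b ≡ true → Ham (adj G)
rotate G {u} {b = b} as bs w₁ w₂ p av ub with walk-reverse (adj-sym G) bs w₂
... | ys , w₃ , p′ = u , as ++ _ ∷ ys , b , walk-++ as w₁ av w₃ , trans (adj-sym G _ _) ub ,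
  ↭-trans (++⁺ˡ (u ∷ as) p′) p

cnt-tail : ∀ {n} (G : Graph n) {u xs} → u ∷ xs ↭ allFin n → cnt (adj G u) xs ≡ deg G u
cnt-tail G {u} {xs} p = trans (cong (λ b → ι b + cnt (adj G u) xs) (sym (irrefl G u))) (cnt-allFin (adj G u) p)

-- Ore's argument: `crossing` finds consecutive `a`, `b` with `a` adjacent to `v` and `b` to `u`,
-- and `rotate` applies.
degree-sum-ham : ∀ {n} (G : Graph n) {u v} → HamPath G u v → n ≤ deg G u + deg G v → Ham (adj G)
degree-sum-ham {n} G {u} {v} (xs , w , p) h with crossing (adj G v) (adj G u) u xs w (irrefl G v) h′
  where
  h′ : length xs < cnt (adj G v) (u ∷ xs) + cnt (adj G u) xs
  h′ = ≤-trans (≤-reflexive (length-allFin p)) (≤-trans h (≤-reflexive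
    (trans (+-comm (deg G u) _) (sym (cong₂ _+_ (cnt-allFin (adj G v) p) (cnt-tail G p))))))
... | as , a , b , bs , refl , w₁ , e , w₂ , va , ub = rotate G as bs w₁ w₂ p (trans (adj-sym G a v) va) ub

module _ {n : ℕ} (G : Graph n) (P : Fin n → Bool)
  (universal : ∀ a y → P a ≡ true → a ≢ y → adj G a y ≡ true) (¬ham : ¬ Ham (adj G)) where

  private
    NonAdj : Fin n → Fin n → Set
    NonAdj a b = adj G a b ≡ false

    P⇒≢ : ∀ {a v} → P v ≡ false → P a ≡ true → a ≢ v
    P⇒≢ f t refl = true≢false (trans (sym t) f)

  -- Otherwise the universal vertices could be used to reconnect the pieces of the path into a cycle.
  successors-independent : ∀ {u v} xs → Walk (adj G) u xs v → u ∷ xs ↭ allFin n → P v ≡ false →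
    AllPairs NonAdj (u ∷ successors {r = adj G} P u xs)
  successors-independent {u} {v} xs w p Pv =
    All.map first (successors-split {r = adj G} P u xs w) ∷ go [] u xs refl w p
    where
    first : ∀ {b} → SplitAt {r = adj G} P u xs v b → NonAdj u b
    first (as , a , bs , refl , w₁ , e , w₂ , Pa) =
      ≢true⇒false λ ub → ¬ham (rotate G as bs w₁ w₂ p (universal a v Pa (P⇒≢ Pv Pa)) ub)

    -- `u ∷ Q` is the part of the path already passed, ending in `x`.
    go : ∀ Q x zs → Walk (adj G) u Q x → Walk (adj G) x zs v → u ∷ Q ++ zs ↭ allFin n →
      AllPairs NonAdj (successors {r = adj G} P x zs)
    go Q x [] _ _ _ = []
    go Q x (z ∷ zs) w₀ (e , w) p with go (Q ++ [ z ]) z zs (walk-++ Q w₀ e refl) w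
                                       (↭-trans (↭-reflexive (cong (u ∷_) (++-assoc Q [ z ] zs))) p)
    ... | rest with P x in Px
    ...   | false = rest
    ...   | true  = All.map pair (successors-split {r = adj G} P z zs w) ∷ rest
      where
      pair : ∀ {b} → SplitAt {r = adj G} P z zs v b → NonAdj z b
      pair {b} (as , a , bs , refl , w₁ , _ , w₂ , Pa) = ≢true⇒false λ zb → ¬ham (cycle zb)
        where
        a≢u : a ≢ u
        a≢u with unique-allFin p
        ... | f ∷ _ = λ g → walk-end-All as w₁ (All.++⁻ˡ (z ∷ as) (All.++⁻ʳ Q f)) (sym g)
        -- The universal vertices `x` and `a` precede `z` and `b`. The cycle runs from `u` to `x`,
        -- jumps to `v`, goes backwards to `b`, takes the chord to `z`, follows the path to `a` and
        -- returns to `u`.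
        cycle : adj G z b ≡ true → Ham (adj G)
        cycle zb with walk-reverse (adj-sym G) bs w₂
        ... | ys , w₃ , p₃ = u , Q ++ v ∷ ys ++ z ∷ as , a ,
          walk-++ Q w₀ (universal x v Px (P⇒≢ Pv Px)) (walk-++ ys w₃ (trans (adj-sym G b z) zb) w₁) ,
          universal a u Pa a≢u ,
          ↭-trans (++⁺ˡ (u ∷ Q) (↭-trans (++-comm (v ∷ ys) (z ∷ as)) (++⁺ˡ (z ∷ as) p₃))) p

-- Bondy's argument: from a Hamiltonian cycle to all lengths

lookup-injective : ∀ {A : Set} {xs : List A} → Unique xs → ∀ i j → List.lookup xs i ≡ List.lookup xs j → i ≡ j
lookup-injective (a ∷ u) zero    zero    e = refl
lookup-injective (a ∷ u) zero    (suc j) e = ⊥-elim (All.lookup a (∈-lookup j) e)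
lookup-injective (a ∷ u) (suc i) zero    e = ⊥-elim (All.lookup a (∈-lookup i) (sym e))
lookup-injective (a ∷ u) (suc i) (suc j) e = cong suc (lookup-injective u i j e)

walk⇒cycle : ∀ {n} (G : Graph n) {x} xs {y} → Walk (adj G) x xs y → adj G y x ≡ true → Unique (x ∷ xs) →
  HasCycle G (suc (length xs))
walk⇒cycle {n} G {x} xs {y} w c u =
  List.lookup (x ∷ xs) , lookup-injective u _ _ , edges xs w , subst (λ z → adj G z x ≡ true) (sym (end xs w)) c
  where
  edges : ∀ {x} xs {y} → Walk (adj G) x xs y → ∀ i →
    adj G (List.lookup (x ∷ xs) (inject₁ i)) (List.lookup (x ∷ xs) (suc i)) ≡ true
  edges (z ∷ zs) (e , w) zero    = e
  edges (z ∷ zs) (e , w) (suc i) = edges zs w i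
  end : ∀ {x} xs {y} → Walk (adj G) x xs y → List.lookup (x ∷ xs) (fromℕ (length xs)) ≡ y
  end []       refl    = refl
  end (_ ∷ zs) (_ , w) = end zs w

prefix-walk : ∀ {A : Set} {r : A → A → Bool} {c} Y {y} Z {b V} → Walk r c Y y → c ∷ Y ≡ Z ++ b ∷ V →
  ∃ λ zs → Walk r c zs b × c ∷ zs ≡ Z ++ [ b ]
prefix-walk Y []      w refl = [] , refl , refl
prefix-walk Y (z ∷ Z) w refl with walk-split Z w
... | a , w₁ , e , _ = Z ++ [ _ ] , walk-++ Z w₁ e refl , refl

module _ {n : ℕ} (G : Graph n) where

  module _ {x y : Fin n} (ms : List (Fin n)) (w : Walk (adj G) x (ms ++ [ y ]) y) (yx : adj G y x ≡ true)
    (u : Unique (x ∷ ms ++ [ y ])) where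

    private
      p q : Fin n → Bool
      p = adj G x
      q = adj G y

    -- Here `b` stands `s` places after `c`, and the cycle is `x`, `c`, ..., `b`, `y`.
    parallel-chords : ∀ s A B K D → ms ≡ A ++ B → ms ≡ K ++ D → length A ≡ s →
      Match p q K B → HasCycle G (3 + s)
    parallel-chords s A B K D refl ms≡ lA (match K₁ K₂ B₁ B₂ c b refl refl l pc qb)
      with cut K₁ {c} {K₂ ++ D} (A ++ B₁) {b} {B₂} s (trans (sym (++-assoc K₁ (c ∷ K₂) D)) (trans (sym ms≡) (sym (++-assoc A B₁ (b ∷ B₂)))))
             (trans (length-++ A) (trans (cong₂ _+_ lA (sym l)) (+-comm s (length K₁))))
    ... | Z , e , lZ , _ with walk-split (K₁) (subst (λ l → Walk (adj G) x l y) whole w)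
      where
      whole : (A ++ B₁ ++ b ∷ B₂) ++ [ y ] ≡ K₁ ++ c ∷ (K₂ ++ D) ++ [ y ]
      whole = trans (cong (_++ [ y ]) (trans ms≡ (++-assoc K₁ (c ∷ K₂) D))) (++-assoc K₁ (c ∷ K₂ ++ D) [ y ])
    ... | _ , _ , _ , w₁ with prefix-walk ((K₂ ++ D) ++ [ y ]) Z w₁ (trans (cong (_++ [ y ]) e) (++-assoc Z (b ∷ B₂) [ y ]))
    ... | zs , w₂ , ez = subst (HasCycle G) len
      (walk⇒cycle G (c ∷ zs ++ [ y ]) (pc , walk-++ zs w₂ (trans (adj-sym G b y) qb) refl) yx
        (unique-++ˡ (x ∷ c ∷ zs ++ [ y ]) (unique-↭ perm u)))
      where
      len : suc (length (c ∷ zs ++ [ y ])) ≡ 3 + s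
      len = cong suc (trans (length-++ (c ∷ zs)) (trans (cong (_+ 1) (trans (cong length ez) (trans (length-++ Z) (cong (_+ 1) lZ)))) (arith s)))
        where
        arith : ∀ s → s + 1 + 1 ≡ 2 + s
        arith = solve-∀
      open PermutationReasoning
      perm : x ∷ (A ++ B₁ ++ b ∷ B₂) ++ [ y ] ↭ (x ∷ c ∷ zs ++ [ y ]) ++ K₁ ++ B₂
      perm = begin
        x ∷ (A ++ B₁ ++ b ∷ B₂) ++ [ y ]
          ≡⟨ cong (λ l → x ∷ l ++ [ y ]) (trans ms≡ (trans (++-assoc K₁ (c ∷ K₂) D) (cong (K₁ ++_) e))) ⟩
        x ∷ (K₁ ++ Z ++ b ∷ B₂) ++ [ y ]
          ↭⟨ Perm.solve 6 (λ X K Z b B y → (X ⊕ (K ⊕ Z ⊕ b ⊕ B) ⊕ y) ⊜ ((X ⊕ (Z ⊕ b) ⊕ y) ⊕ K ⊕ B)) ↭-refl [ x ] K₁ Z [ b ] B₂ [ y ] ⟩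
        ([ x ] ++ (Z ++ [ b ]) ++ [ y ]) ++ K₁ ++ B₂
          ≡⟨ cong (λ l → ([ x ] ++ l ++ [ y ]) ++ K₁ ++ B₂) (sym ez) ⟩
        (x ∷ c ∷ zs ++ [ y ]) ++ K₁ ++ B₂ ∎
        where open Perm

    -- Here `d` stands `suc k` places after `a`. The cycle follows the path from `x` to `a`, takes
    -- the chord to `y`, goes back to `d` and closes at `x`; it skips the `k` vertices between `a`
    -- and `d`.
    crossed-chords : ∀ s k A B K D → ms ≡ A ++ B → ms ≡ K ++ D → length A ≡ s → length D ≡ s → length K ≡ suc k →
      Match q p A D → HasCycle G (3 + s)
    crossed-chords s k A B K D refl ms≡ lA lD lC (match A₁ A₂ D₁ D₂ a d refl refl l qa pd)
      with cut A₁ {a} {A₂ ++ B} (K ++ D₁) {d} {D₂} (suc k) (trans (sym (++-assoc A₁ (a ∷ A₂) B)) (trans ms≡ (sym (++-assoc K D₁ (d ∷ D₂)))))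
             (trans (length-++ K) (trans (cong₂ _+_ lC (sym l)) (+-comm (suc k) (length A₁))))
    ... | [] , _ , () , _
    ... | a′ ∷ Z , e , _ , eC with ∷-injectiveˡ e
    ... | refl with walk-split A₁ (subst (λ l → Walk (adj G) x l y) whole w)
      where
      whole : ((A₁ ++ a ∷ A₂) ++ B) ++ [ y ] ≡ A₁ ++ a ∷ Z ++ d ∷ D₂ ++ [ y ]
      whole = trans (cong (_++ [ y ]) (trans (++-assoc A₁ (a ∷ A₂) B) (cong (A₁ ++_) e)))
                    (trans (++-assoc A₁ (a ∷ Z ++ d ∷ D₂) [ y ]) (cong (λ l → A₁ ++ a ∷ l) (++-assoc Z (d ∷ D₂) [ y ])))
    ... | a₀ , w₀ , e₀ , w₁ with walk-split Z w₁
    ... | _ , _ , _ , w₂ with walk-reverse (adj-sym G) (D₂ ++ [ y ]) w₂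
    ... | ys , w₃ , p₃ = subst (HasCycle G) len
      (walk⇒cycle G (A₁ ++ a ∷ y ∷ ys) (walk-++ A₁ w₀ e₀ (trans (adj-sym G a y) qa , w₃)) (trans (adj-sym G d x) pd)
        (unique-++ˡ (x ∷ A₁ ++ a ∷ y ∷ ys) (unique-↭ perm u)))
      where
      len : suc (length (A₁ ++ a ∷ y ∷ ys)) ≡ 3 + s
      len = begin
        suc (length (A₁ ++ a ∷ y ∷ ys))          ≡⟨ cong suc (length-++ A₁) ⟩
        suc (length A₁ + suc (length (y ∷ ys)))  ≡⟨ cong (λ l → suc (length A₁ + suc l)) (trans (↭-length p₃) (cong suc (length-++ D₂))) ⟩
        suc (length A₁ + suc (suc (length D₂ + 1))) ≡⟨ arith (length A₁) (length D₂) ⟩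
        3 + (length A₁ + suc (length D₂))        ≡⟨ cong (λ l → 3 + (l + suc (length D₂))) l ⟩
        3 + (length D₁ + suc (length D₂))        ≡⟨ cong (3 +_) (sym (length-++ D₁)) ⟩
        3 + length (D₁ ++ d ∷ D₂)                ≡⟨ cong (3 +_) lD ⟩
        3 + s ∎
        where
        open ≡-Reasoning
        arith : ∀ a d → suc (a + suc (suc (d + 1))) ≡ 3 + (a + suc d)
        arith = solve-∀
      open PermutationReasoning
      perm : x ∷ ((A₁ ++ a ∷ A₂) ++ B) ++ [ y ] ↭ (x ∷ A₁ ++ a ∷ y ∷ ys) ++ Z
      perm = begin
        x ∷ ((A₁ ++ a ∷ A₂) ++ B) ++ [ y ]
          ≡⟨ cong (λ l → x ∷ l ++ [ y ]) (trans (++-assoc A₁ (a ∷ A₂) B) (cong (A₁ ++_) e)) ⟩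
        [ x ] ++ (A₁ ++ [ a ] ++ Z ++ d ∷ D₂) ++ [ y ]
          ↭⟨ Perm.solve 6 (λ X A a Z D y → (X ⊕ (A ⊕ a ⊕ Z ⊕ D) ⊕ y) ⊜ ((X ⊕ A ⊕ a ⊕ (D ⊕ y)) ⊕ Z)) ↭-refl [ x ] A₁ [ a ] Z (d ∷ D₂) [ y ] ⟩
        ([ x ] ++ A₁ ++ [ a ] ++ (d ∷ D₂ ++ [ y ])) ++ Z
          ↭⟨ ++⁺ʳ Z (++⁺ˡ (x ∷ A₁) (↭-prep a (↭-sym p₃))) ⟩
        ([ x ] ++ A₁ ++ [ a ] ++ (y ∷ ys)) ++ Z ∎
        where open Perm

    -- Bondy: if x ~ msⱼ and y ~ msⱼ₊ₛ with the index read modulo the length of ms, then these two chords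
    -- together with xy close a cycle of length 3 + s; there is such a j by the degree sum.
    bondy-pair : x ∷ ms ++ [ y ] ↭ allFin n → n < deg G x + deg G y → ∀ s k → length ms ≡ s + suc k → HasCycle G (3 + s)
    bondy-pair perm dn s k lms = choose (length K <? cnt p K + cnt q B) (length A <? cnt q A + cnt p D)
      where
      A = take s ms
      B = drop s ms
      K = take (suc k) ms
      D = drop (suc k) ms
      AB : ms ≡ A ++ B
      AB = sym (take++drop≡id s ms)
      CD : ms ≡ K ++ D
      CD = sym (take++drop≡id (suc k) ms)
      lA : length A ≡ s
      lA = trans (length-take s ms) (m≤n⇒m⊓n≡m (≤-trans (m≤m+n s (suc k)) (≤-reflexive (sym lms))))
      lB : length B ≡ suc k
      lB = trans (length-drop s ms) (trans (cong (_∸ s) lms) (m+n∸m≡n s (suc k)))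
      lC : length K ≡ suc k
      lC = trans (length-take (suc k) ms) (m≤n⇒m⊓n≡m (≤-trans (m≤n+m (suc k) s) (≤-reflexive (sym lms))))
      lD : length D ≡ s
      lD = trans (length-drop (suc k) ms) (trans (cong (_∸ suc k) lms) (m+n∸n≡m s (suc k)))

      deg-x : cnt p ms + 1 ≡ deg G x
      deg-x = trans (sym (trans (cnt-++ p ms [ y ]) (cong (λ b → cnt p ms + (ι b + 0)) (trans (adj-sym G x y) yx)))) (cnt-tail G perm)
      deg-y : 1 + cnt q ms ≡ deg G y
      deg-y = trans (sym (trans (cong₂ _+_ (cong ι yx) (cnt-++ q ms [ y ]))
                (trans (cong (λ b → 1 + (cnt q ms + (ι b + 0))) (irrefl G y)) (cong suc (+-identityʳ _))))) (cnt-allFin q perm)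
      order : n ≡ 2 + (s + suc k)
      order = trans (sym (length-allFin perm)) (cong suc (trans (length-++ ms) (trans (+-comm _ 1) (cong suc lms))))

      -- Without the edge `xy` the two degrees still sum to more than `n - 2`, which is the number
      -- of slots: `suc k` for aligning `K` with `B` and `s` for `A` with `D`. One of the two
      -- alignments must overflow.
      total : s + suc k < cnt p K + cnt q B + (cnt q A + cnt p D)
      total = +-cancelˡ-< 2 _ _ (≤-trans (≤-reflexive (cong suc (sym order))) (≤-trans dn (≤-reflexive sums)))
        where
        arith : ∀ a b c d → (a + d + 1) + (1 + (c + b)) ≡ 2 + (a + b + (c + d))
        arith = solve-∀
        sums : deg G x + deg G y ≡ 2 + (cnt p K + cnt q B + (cnt q A + cnt p D))
        sums = trans (cong₂ _+_
          (trans (sym deg-x) (cong (_+ 1) (trans (cong (cnt p) CD) (cnt-++ p K D))))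
          (trans (sym deg-y) (cong suc (trans (cong (cnt q) AB) (cnt-++ q A B)))))
          (arith (cnt p K) (cnt q B) (cnt q A) (cnt p D))

      choose : Dec (length K < cnt p K + cnt q B) → Dec (length A < cnt q A + cnt p D) → HasCycle G (3 + s)
      choose (yes h) _ = parallel-chords s A B K D AB CD lA (pigeonhole p q K B (trans lC (sym lB)) h)
      choose _ (yes h) = crossed-chords s k A B K D AB CD lA lD lC (pigeonhole q p A D (trans lA (sym lD)) h)
      choose (no h₁) (no h₂) = ⊥-elim (<⇒≱ total (≤-trans (+-mono-≤ (≮⇒≥ h₁) (≮⇒≥ h₂))
        (≤-reflexive (trans (cong₂ _+_ lC lA) (+-comm (suc k) s)))))

  bondy-at : ∀ {x y} xs → Walk (adj G) x xs y → adj G y x ≡ true → x ∷ xs ↭ allFin n → n < deg G x + deg G y →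
    ∀ ℓ → 3 ≤ ℓ → ℓ ≤ n → HasCycle G ℓ
  bondy-at [] w c perm h ℓ ℓ≥3 ℓ≤n = contradiction (≤-trans ℓ≥3 (≤-trans ℓ≤n (≤-reflexive (sym (length-allFin perm))))) λ { (s≤s ()) }
  bondy-at (z ∷ zs) w c perm h (suc zero) (s≤s ())
  bondy-at (z ∷ zs) w c perm h (suc (suc zero)) (s≤s (s≤s ()))
  bondy-at {x} {y} (z ∷ zs) w@(e , w′) c perm h (suc (suc (suc s))) _ ℓ≤n with walk-last zs w′
  ... | ms , eq = bondy-pair ms (subst (λ l → Walk (adj G) x l y) eq w) c (unique-allFin perm′) perm′ h s (length ms ∸ suc s) lms
    where
    perm′ : x ∷ ms ++ [ y ] ↭ allFin n
    perm′ = subst (λ l → x ∷ l ↭ allFin n) eq perm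
    s<ms : suc s ≤ length ms
    s<ms = +-cancelˡ-≤ 2 _ _ (≤-trans ℓ≤n (≤-reflexive (trans (sym (length-allFin perm′)) (cong suc (trans (length-++ ms) (+-comm _ 1))))))
    lms : length ms ≡ s + suc (length ms ∸ suc s)
    lms = sym (trans (+-suc s _) (m+[n∸m]≡n s<ms))

  -- If every two consecutive vertices of the cycle had degree sum at most `n`, summing around it
  -- would give at most `n * n` for twice the total degree. So some consecutive pair exceeds `n`,
  -- and the cycle is reopened there for `bondy-at`.
  bondy : Ham (adj G) → n * n < 2 * Σdeg (adj G) → Pancyclic G
  bondy (x , xs , y , w , c , perm) big ℓ ℓ≥3 ℓ≤n with heavy x xs w
    where
    d = deg G
    Heavy : Fin n → List (Fin n) → Fin n → Set
    Heavy a zs y = ∃₂ λ as e → ∃₂ λ b bs → zs ≡ as ++ b ∷ bs × Walk (adj G) a as e ×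
      adj G e b ≡ true × Walk (adj G) b bs y × n < d b + d e
    -- The sum on the left is the sum of the degree sums of all steps, plus the degree of the last
    -- vertex, which is no tail.
    heavy : ∀ a zs {y} → Walk (adj G) a zs y → Heavy a zs y ⊎ sum (map d (a ∷ zs)) + sum (map d zs) ≤ length zs * n + d y
    heavy a [] refl = inj₂ (≤-reflexive (trans (+-identityʳ _) (+-identityʳ (d a))))
    heavy a (z ∷ zs) (e , w) with n <? d z + d a
    ... | yes h = inj₁ ([] , a , z , zs , refl , refl , e , w , h)
    ... | no h with heavy z zs w
    ...   | inj₁ (as , e′ , b , bs , i , u , j) = inj₁ (z ∷ as , e′ , b , bs , cong (z ∷_) i , (e , u) , j)
    ...   | inj₂ g = inj₂ (≤-trans (≤-reflexive (arith (d a) (d z + sum (map d zs)) (d z) (sum (map d zs))))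
                          (≤-trans (+-mono-≤ (≮⇒≥ h) g) (≤-reflexive (sym (+-assoc n _ _)))))
      where
      arith : ∀ a s z t → a + s + (z + t) ≡ z + a + (s + t)
      arith = solve-∀
  ... | inj₁ (as , e , b , bs , refl , w₁ , eb , w₂ , h) =
    bondy-at (bs ++ x ∷ as) (walk-++ bs w₂ c w₁) eb (↭-trans (++-comm (b ∷ bs) (x ∷ as)) perm) h ℓ ℓ≥3 ℓ≤n
  ... | inj₂ g with n <? deg G x + deg G y
  ...   | yes h = bondy-at xs w c perm h ℓ ℓ≥3 ℓ≤n
  ...   | no h  = ⊥-elim (<⇒≱ big (≤-trans (≤-reflexive twice) (≤-trans (+-monoʳ-≤ (deg G x) g)
                (≤-trans (≤-reflexive arith′) (≤-trans (+-monoʳ-≤ (length xs * n) (≮⇒≥ h)) (≤-reflexive square))))))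
    where
    Σxs = sum (map (deg G) xs)
    twice : 2 * Σdeg (adj G) ≡ deg G x + (sum (map (deg G) (x ∷ xs)) + Σxs)
    twice = trans (cong (2 *_) (trans (sumFin≡sum (deg G)) (sym (sum-↭ (map⁺ (deg G) perm))))) (arith (deg G x) Σxs)
      where
      arith : ∀ a s → 2 * (a + s) ≡ a + (a + s + s)
      arith = solve-∀
    arith′ : deg G x + (length xs * n + deg G y) ≡ length xs * n + (deg G x + deg G y)
    arith′ = trans (sym (+-assoc (deg G x) _ _)) (trans (cong (_+ deg G y) (+-comm (deg G x) _)) (+-assoc (length xs * n) _ _))
    square : length xs * n + n ≡ n * n
    square = trans (+-comm _ n) (cong (_* n) (length-allFin perm))

-- The numerical inequality and its finite check

2*nC2 : ∀ k → 2 * (suc k C 2) ≡ suc k * k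
2*nC2 zero    = refl
2*nC2 (suc k) = begin
  2 * (suc (suc k) C 2)           ≡⟨ cong (2 *_) (sym (nCk+nC[k+1]≡[n+1]C[k+1] (suc k) 1)) ⟩
  2 * (suc k C 1 + suc k C 2)     ≡⟨ *-distribˡ-+ 2 (suc k C 1) _ ⟩
  2 * (suc k C 1) + 2 * (suc k C 2) ≡⟨ cong₂ _+_ (cong (2 *_) (nC1≡n (suc k))) (2*nC2 k) ⟩
  2 * suc k + suc k * k           ≡⟨ arith k ⟩
  suc (suc k) * suc k ∎
  where
  open ≡-Reasoning
  arith : ∀ k → 2 * suc k + suc k * k ≡ suc (suc k) * suc k
  arith = solve-∀

allBelow : ℕ → (ℕ → Bool) → Bool
allBelow zero    f = true
allBelow (suc k) f = f k ∧ allBelow k f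

allBelow-sound : ∀ k f → allBelow k f ≡ true → ∀ {i} → i < k → f i ≡ true
allBelow-sound (suc k) f p {i} i<k with m≤n⇒m<n∨m≡n (≤-pred i<k)
... | inj₁ q    = allBelow-sound k f (proj₂ (∧-true p)) q
... | inj₂ refl = proj₁ (∧-true p)

≤ᵇ-true : ∀ {m n} → m ≤ n → (m ≤ᵇ n) ≡ true
≤ᵇ-true {m} {n} p with m ≤ᵇ n in q
... | true  = refl
... | false = ⊥-elim (subst T q (≤⇒≤ᵇ p))

true-≤ᵇ : ∀ {m n} → (m ≤ᵇ n) ≡ true → m ≤ n
true-≤ᵇ {m} {n} p = ≤ᵇ⇒≤ m n (subst T (sym p) _)

-- With D the largest degree of a non-universal vertex v, e = 2t + e′ the number of non-neighbours of v,
-- i the largest degree among these and a the number of universal vertices (so n = 1 + e + D),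
-- this is what the lower bound on the size leaves.
Star : (t e′ D i a : ℕ) → Set
Star t e′ D i a = e′ * (e′ + 2 * D + 1) + 6 * (t * t) ≤ (2 * t + e′) * (i + a)

-- Write `e` for `2 * t + e′`. Bounding `i + a` by `2 * D` next to the factor `e′` and by `2 * e`
-- next to `2 * t` cancels the terms in `e′ * D`; what remains fails for `e′` at least `5 * t`.
-- Bounding `i + a` by `2 * e` throughout limits `D`. Only finitely many parameters survive.
star-bounds : ∀ t e′ D i a → 1 ≤ t → 1 ≤ e′ → i ≤ D → i ≤ 2 * t + e′ → a ≤ i → Star t e′ D i a →
  e′ < 5 * t × D ≤ (2 * t + e′) * (2 * t + e′)
star-bounds t e′ D i a t≥1 e′≥1 i≤D i≤e a≤i star = ≰⇒> small , *-cancelˡ-≤ 2 (begin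
  2 * D                              ≤⟨ m≤n*m (2 * D) e′ {{>-nonZero e′≥1}} ⟩
  e′ * (2 * D)                       ≤⟨ *-monoʳ-≤ e′ (≤-trans (m≤n+m (2 * D) e′) (m≤m+n _ 1)) ⟩
  e′ * (e′ + 2 * D + 1)              ≤⟨ m≤m+n _ (6 * (t * t)) ⟩
  e′ * (e′ + 2 * D + 1) + 6 * (t * t) ≤⟨ star ⟩
  e * (i + a)                        ≤⟨ *-monoʳ-≤ e (+-mono-≤ i≤e (≤-trans a≤i i≤e)) ⟩
  e * (e + e)                        ≡⟨ arith e ⟩
  2 * (e * e) ∎)
  where
  open ≤-Reasoning
  e = 2 * t + e′
  arith : ∀ e → e * (e + e) ≡ 2 * (e * e)
  arith = solve-∀
  upper : e′ * (e′ + 2 * D + 1) + 6 * (t * t) ≤ 2 * t * (e + e) + e′ * (D + D)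
  upper = begin
    e′ * (e′ + 2 * D + 1) + 6 * (t * t) ≤⟨ star ⟩
    e * (i + a)                         ≡⟨ *-distribʳ-+ (i + a) (2 * t) e′ ⟩
    2 * t * (i + a) + e′ * (i + a)      ≤⟨ +-mono-≤ (*-monoʳ-≤ (2 * t) (+-mono-≤ i≤e (≤-trans a≤i i≤e)))
                                                     (*-monoʳ-≤ e′ (+-mono-≤ i≤D (≤-trans a≤i i≤D))) ⟩
    2 * t * (e + e) + e′ * (D + D) ∎
  -- With `e′ = 5 * t + k`, the left side exceeds the upper bound by an amount that is visibly at
  -- least `t`.
  excess : ∀ t k D → (5 * t + k) * (5 * t + k + 2 * D + 1) + 6 * (t * t) ≡
    (2 * t * ((2 * t + (5 * t + k)) + (2 * t + (5 * t + k))) + (5 * t + k) * (D + D)) + (t + (4 * t + k + k * k + 6 * (t * k) + 3 * (t * t)))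
  excess = solve-∀
  small : ¬ (5 * t ≤ e′)
  small h with m≤n⇒∃[o]m+o≡n h
  ... | k , refl = <⇒≱ t≥1 (≤-trans (m≤m+n t (4 * t + k + k * k + 6 * (t * k) + 3 * (t * t))) (+-cancelˡ-≤ _ _ 0
          (≤-trans (≤-reflexive (sym (excess t k D))) (≤-trans upper (≤-reflexive (sym (+-identityʳ _)))))))

module _ (t n₀ : ℕ) where

  private
    order : ℕ → ℕ → ℕ
    order e′ D = 1 + (2 * t + e′) + D

  -- The right side of `Star` grows with `i`, so `i` is replaced by its upper bound, the minimum of
  -- `D` and `2 * t + e′`, and need not be searched.
  starCheck : ℕ → ℕ → ℕ → Bool
  starCheck e′ D a =
    not (n₀ ≤ᵇ order e′ D) ∨
    (not (e′ * (e′ + 2 * D + 1) + 6 * (t * t) ≤ᵇ (2 * t + e′) * (D ⊓ (2 * t + e′) + a)) ∨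
    ((suc (order e′ D) ≤ᵇ suc t * suc a) ∨ (D ≤ᵇ suc a)))

  -- The ranges come from `star-bounds` and `a < i`; `suc e` stands for `e′`, which is positive
  -- here.
  starCheckAll : Bool
  starCheckAll = allBelow (5 * t) λ e → allBelow (suc ((2 * t + suc e) * (2 * t + suc e))) λ D →
    allBelow (D ⊓ (2 * t + suc e)) (starCheck (suc e) D)

  StarConclusion : Set
  StarConclusion = ∀ e D i a → n₀ ≤ order (suc e) D → i ≤ D → i ≤ 2 * t + suc e → a < i →
    Star t (suc e) D i a → order (suc e) D < suc t * suc a ⊎ D ≤ suc a

  star-conclusion : 1 ≤ t → starCheckAll ≡ true → StarConclusion
  star-conclusion t≥1 check e D i a n≥ i≤D i≤e a<i star
    with star-bounds t (suc e) D i a t≥1 (s≤s z≤n) i≤D i≤e (<⇒≤ a<i) star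
  ... | e< , D≤ with ∨-true {not (n₀ ≤ᵇ order (suc e) D)} checked
    where
    checked : starCheck (suc e) D a ≡ true
    checked = allBelow-sound _ _ (allBelow-sound _ _ (allBelow-sound (5 * t) _ check (<⇒≤ e<)) (s≤s D≤))
                (≤-trans a<i (⊓-glb i≤D i≤e))
  ... | inj₁ p = contradiction (trans (sym p) (cong not (≤ᵇ-true n≥))) λ ()
  ... | inj₂ q with ∨-true {not (suc e * (suc e + 2 * D + 1) + 6 * (t * t) ≤ᵇ (2 * t + suc e) * (D ⊓ (2 * t + suc e) + a))} q
  ... | inj₁ p = contradiction (trans (sym p) (cong not (≤ᵇ-true (≤-trans star
                   (*-monoʳ-≤ (2 * t + suc e) (+-monoˡ-≤ a (⊓-glb i≤D i≤e))))))) λ ()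
  ... | inj₂ r with ∨-true {suc (order (suc e) D) ≤ᵇ suc t * suc a} r
  ... | inj₁ p = inj₁ (true-≤ᵇ p)
  ... | inj₂ p = inj₂ (true-≤ᵇ p)

-- Holds by evaluating the check, as do the next two; parameters giving an order below the second
-- argument pass it trivially.
star₁ : StarConclusion 1 7
star₁ = star-conclusion 1 7 (s≤s z≤n) refl

star₂ : StarConclusion 2 16
star₂ = star-conclusion 2 16 (s≤s z≤n) refl

star₃ : StarConclusion 3 28
star₃ = star-conclusion 3 28 (s≤s z≤n) refl

-- Universal vertices and consequences of toughness

codeg-zero : ∀ {n} (G : Graph n) {x} → codeg G x ≡ 0 → ∀ y → x ≢ y → adj G x y ≡ true
codeg-zero G p y q = coadj-false G (count-zero p y) q

complete-ham : ∀ {n} (G : Graph n) → 3 ≤ n → (∀ x y → x ≢ y → adj G x y ≡ true) → Ham (adj G)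
complete-ham {suc zero} G (s≤s ()) complete
complete-ham {suc (suc m)} G _ complete with unique-allFin {suc (suc m)} ↭-refl
... | 0≢ ∷ u with walk _ _ u
  where
  walk : ∀ x xs → Unique (x ∷ xs) → ∃ λ y → Walk (adj G) x xs y
  walk x []       _             = x , refl
  walk x (z ∷ zs) ((x≢z ∷ _) ∷ u) with walk z zs u
  ... | y , w = y , complete x z x≢z , w
... | y , w = zero , _ , y , (complete zero (suc zero) (λ ()) , w) ,
  complete y zero (walk-end-All {Q = λ y → y ≢ zero} _ w (All.map (λ f g → f (sym g)) 0≢)) , ↭-refl

-- The form in which toughness is applied: a colouring with distinct representatives `R` stands in
-- for the components left after deleting `f`.
tough-bound : ∀ {n t} (G : Graph n) → Tough t G → (f : Fin n → Bool) (col : Fin n → Fin n) →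
  (∀ x y → f x ≡ false → f y ≡ false → adj G x y ≡ true → col x ≡ col y) →
  ∀ R → Unique R → All (λ r → f r ≡ false × col r ≡ r) R → 2 ≤ length R → t * length R ≤ count f
tough-bound {t = t} G tough f col col-adj R uR aR l = begin
  t * length R          ≤⟨ *-monoʳ-≤ t R≤ ⟩
  t * components G S    ≤⟨ tough S (≤-trans l R≤) ⟩
  ∣ S ∣                 ≡⟨ ∣tabulate∣ f ⟩
  count f ∎
  where
  open ≤-Reasoning
  S = tabulate f
  R≤ : length R ≤ components G S
  R≤ = components-≥ G S col
    (λ x y p q → col-adj x y (trans (sym (lookup∘tabulate f x)) p) (trans (sym (lookup∘tabulate f y)) q))
    R uR (All.map (λ { {r} (p , q) → trans (lookup∘tabulate f r) p , q }) aR)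

allPairs-lookup : ∀ {A : Set} {R : A → A → Set} → (∀ {x y} → R x y → R y x) → ∀ {xs x y} →
  AllPairs R xs → x ∈ xs → y ∈ xs → x ≢ y → R x y
allPairs-lookup s (a ∷ as) (here refl) (here refl) ne = ⊥-elim (ne refl)
allPairs-lookup s (a ∷ as) (here refl) (there q)   ne = All.lookup a q
allPairs-lookup s (a ∷ as) (there p)   (here refl) ne = s (All.lookup a p)
allPairs-lookup s (a ∷ as) (there p)   (there q)   ne = allPairs-lookup s as p q ne

module Universal {n : ℕ} (G : Graph n) where

  infix 4 _~_ _≁_
  _~_ _≁_ : Fin n → Fin n → Set
  x ~ y = adj G x y ≡ true
  x ≁ y = adj G x y ≡ false

  ~-sym : ∀ {x y} → x ~ y → y ~ x
  ~-sym {x} {y} p = trans (adj-sym G y x) p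

  U : Fin n → Bool
  U x = codeg G x ≤ᵇ 0

  universal : ∀ x y → U x ≡ true → x ≢ y → x ~ y
  universal x y p q = codeg-zero G (n≤0⇒n≡0 (true-≤ᵇ p)) y q

  nonuniversal : ∀ {x y} → coadj G x y ≡ true → U x ≡ false
  nonuniversal {x} {y} p = ≢true⇒false λ q → true≢false (trans (sym p) (count-zero {f = coadj G x} (n≤0⇒n≡0 (true-≤ᵇ q)) y))

  nonneighbour : ∀ {x} → U x ≡ false → ∃ λ y → coadj G x y ≡ true
  nonneighbour {x} p with Fin.any? (λ y → coadj G x y Bool.≟ true)
  ... | yes q = q
  ... | no ¬q = contradiction (trans (sym p) (≤ᵇ-true (≤-reflexive zero-codeg))) λ ()
    where
    zero-codeg : codeg G x ≡ 0
    zero-codeg = trans (count-cong (λ y → ≢true⇒false (λ r → ¬q (y , r)))) (n≤0⇒n≡0 (unique-free n))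
      where
      unique-free : ∀ m → count {m} (λ _ → false) ≤ 0
      unique-free zero    = z≤n
      unique-free (suc m) = unique-free m

  U⇒~ : ∀ {x y} → U x ≡ false → U y ≡ true → x ~ y
  U⇒~ {x} {y} p q = ~-sym (universal y x q λ { refl → true≢false (trans (sym q) p) })

  some-nonuniversal : 3 ≤ n → ¬ Ham (adj G) → ∃ λ x → U x ≡ false
  some-nonuniversal n≥3 ¬ham with Fin.any? (λ x → U x Bool.≟ false)
  ... | yes p = p
  ... | no ¬p = ⊥-elim (¬ham (complete-ham G n≥3 λ x y → universal x y (≢false⇒true λ q → ¬p (x , q))))

module _ {n t : ℕ} (G : Graph n) (tough : Tough t G) (I : List (Fin n)) (I-unique : Unique I)
  (I-independent : AllPairs (λ x y → adj G x y ≡ false) I) (long : 2 ≤ length I) where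

  open Universal G
  open import Data.List.Membership.DecPropositional (Fin._≟_ {n}) using (_∈?_)

  I-≁ : ∀ {x y} → x ∈ I → y ∈ I → x ≁ y
  I-≁ {x} {y} p q with x Fin.≟ y
  ... | yes refl = irrefl G x
  ... | no x≢y   = allPairs-lookup (λ {x} {y} r → trans (adj-sym G y x) r) I-independent p q x≢y

  -- Deleting all vertices outside `I` leaves the members of `I` isolated, so at least
  -- `t * length I` vertices were deleted.
  tough-independent : suc t * length I ≤ n
  tough-independent = begin
    length I + t * length I         ≤⟨ +-mono-≤ (unique-length≤count inI I I-unique (All.tabulate inI-true))
                                         (tough-bound {t = t} G tough (not ∘ inI) (λ x → x) col-adj I I-unique
                                           (All.tabulate (λ p → cong not (inI-true p) , refl))
                                           long) ⟩
    count inI + count (not ∘ inI)   ≡⟨ count-not inI ⟩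
    n ∎
    where
    open ≤-Reasoning
    inI : Fin n → Bool
    inI x = ⌊ x ∈? I ⌋
    inI-true : ∀ {x} → x ∈ I → inI x ≡ true
    inI-true {x} p with x ∈? I
    ... | yes _ = refl
    ... | no ¬p = ⊥-elim (¬p p)
    true-inI : ∀ {x} → not (inI x) ≡ false → x ∈ I
    true-inI {x} p with x ∈? I
    ... | yes q = q
    col-adj : ∀ x y → not (inI x) ≡ false → not (inI y) ≡ false → x ~ y → x ≡ y
    col-adj x y p q r = ⊥-elim (true≢false (trans (sym r) (I-≁ (true-inI p) (true-inI q))))

  -- Every vertex has at most one neighbour outside U, so the vertices of I lie in different components of G - U.
  separated : Fin n → (∀ {x} → x ∈ I → U x ≡ false) → (∀ x → U x ≡ false → deg G x ≤ suc (count U)) →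
    t * length I ≤ count U
  separated u I-nonuniversal deg≤ = tough-bound {t = t} G tough U col col-adj I I-unique
    (All.tabulate (λ p → I-nonuniversal p , col-I p)) long
    where
    col : Fin n → Fin n
    col x with x ∈? I | Fin.any? (λ y → y ∈? I ×-dec (adj G x y Bool.≟ true))
    ... | yes _ | _           = x
    ... | no _  | yes (y , _) = y
    -- A default value. It may agree with the colour of a member of `I`, since only equality along
    -- edges is required.
    ... | no _  | no _        = u

    data Spec (x : Fin n) : Fin n → Set where
      inside  : x ∈ I → Spec x x
      beside  : ∀ {y} → ¬ (x ∈ I) → y ∈ I → x ~ y → Spec x y
      outside : (∀ y → y ∈ I → ¬ (x ~ y)) → ¬ (x ∈ I) → Spec x u

    spec : ∀ x → Spec x (col x)
    spec x with x ∈? I | Fin.any? (λ y → y ∈? I ×-dec (adj G x y Bool.≟ true))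
    ... | yes p | _               = inside p
    ... | no ¬p | yes (y , q , r) = beside ¬p q r
    ... | no ¬p | no ¬q           = outside (λ y p r → ¬q (y , p , r)) ¬p

    col-I : ∀ {x} → x ∈ I → col x ≡ x
    col-I {x} p with x ∈? I
    ... | yes _ = refl
    ... | no ¬p = ⊥-elim (¬p p)

    -- All of `U` is adjacent to `x`, and its degree leaves room for just one more neighbour.
    unique-neighbour : ∀ {x y z} → U x ≡ false → U y ≡ false → U z ≡ false → x ~ y → x ~ z → y ≡ z
    unique-neighbour {x} {y} {z} Ux Uy Uz xy xz with y Fin.≟ z
    ... | yes p = p
    ... | no y≢z = ⊥-elim (<⇒≱ (≤-<-trans a<f f<deg) (deg≤ x Ux))
      where
      f : Fin n → Bool
      f w = U w ∨ ⌊ y Fin.≟ w ⌋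
      a<f : suc (count U) ≤ count f
      a<f = count-mono-< {f = U} {f} (λ w → ∨-introˡ) y Uy (∨-introʳ (≟-refl y))
      f⇒~ : ∀ w → f w ≡ true → x ~ w
      f⇒~ w p with ∨-true {U w} p
      ... | inj₁ q = U⇒~ Ux q
      ... | inj₂ q = subst (x ~_) (≟-true q) xy
      f<deg : count f < deg G x
      f<deg = count-mono-< {f = f} {adj G x} f⇒~ z (trans (cong (_∨ ⌊ y Fin.≟ z ⌋) Uz) (≟-false y≢z)) xz

    col-adj : ∀ x y → U x ≡ false → U y ≡ false → x ~ y → col x ≡ col y
    col-adj x y Ux Uy r = compare (spec x) (spec y)
      where
      compare : ∀ {c d} → Spec x c → Spec y d → c ≡ d
      compare (inside p)     (inside q)     = ⊥-elim (true≢false (trans (sym r) (I-≁ p q)))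
      compare (inside p)     (beside _ q s) = unique-neighbour Uy Ux (I-nonuniversal q) (~-sym r) s
      compare (inside p)     (outside f _)  = ⊥-elim (f x p (~-sym r))
      compare (beside _ q s) (inside p)     = unique-neighbour Ux (I-nonuniversal q) Uy s r
      compare (beside _ q s) (beside ¬p _ _) with unique-neighbour Ux (I-nonuniversal q) Uy s r
      ... | refl = ⊥-elim (¬p q)
      compare (beside _ q s) (outside _ ¬p) with unique-neighbour Ux (I-nonuniversal q) Uy s r
      ... | refl = ⊥-elim (¬p q)
      compare (outside f _)  (inside p)     = ⊥-elim (f y p r)
      compare (outside _ ¬p) (beside _ q s) with unique-neighbour Uy (I-nonuniversal q) Ux s (~-sym r)
      ... | refl = ⊥-elim (¬p q)
      compare (outside _ _)  (outside _ _)  = refl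

-- Contradiction for an edge-maximal non-Hamiltonian graph

module Core {t n n₀ : ℕ} (t≥1 : 1 ≤ t) (n≥n₀ : n₀ ≤ n) (n-large : 2 * (t * t) + 2 * t + 1 < n)
  (conclusion : StarConclusion t n₀) (G : Graph n) (tough : Tough t G)
  (dense : 2 * ((n ∸ 2 * t) C 2 + 3 * (t * t)) ≤ Σdeg (adj G))
  (path : ∀ u v → u ≢ v → adj G u v ≡ false → HamPath G u v) (¬ham : ¬ Ham (adj G))
  (v : Fin n) (Uv : Universal.U G v ≡ false) (deg≤D : ∀ x → Universal.U G x ≡ false → deg G x ≤ deg G v)
  (u : Fin n) (Lu : coadj G v u ≡ true) (deg≤i : ∀ x → coadj G v x ≡ true → deg G x ≤ deg G u) where

  open Universal G

  a = count U
  D = deg G v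
  e = codeg G v
  L = coadj G v
  i = deg G u

  L⇒¬U : ∀ {x} → L x ≡ true → U x ≡ false
  L⇒¬U p = nonuniversal (coadj-sym G p)

  Uu : U u ≡ false
  Uu = L⇒¬U Lu
  v≢u : v ≢ u
  v≢u = proj₂ (coadj-true G Lu)
  v≁u : v ≁ u
  v≁u = proj₁ (coadj-true G Lu)
  u≁v : u ≁ v
  u≁v = trans (adj-sym G u v) v≁u
  Lv : L v ≡ false
  Lv = ≢true⇒false λ p → proj₂ (coadj-true G p) refl

  order : D + e + 1 ≡ n
  order = deg+codeg G v

  degree-sum : ∀ {x y} → x ≢ y → x ≁ y → deg G x + deg G y < n
  degree-sum {x} {y} p q = ≰⇒> λ h → ¬ham (degree-sum-ham G (path x y p q) h)

  i≤D : i ≤ D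
  i≤D = deg≤D u Uu

  -- As `u` and `v` are non-adjacent, `D + i < n = D + e + 1`.
  i≤e : i ≤ e
  i≤e = ≤-by (degree-sum v≢u v≁u) (≤-reflexive (trans (cong (i +_) (sym order)) (arith i D e)))
    where
    arith : ∀ i D e → i + (D + e + 1) ≡ e + suc (D + i)
    arith = solve-∀

  -- Deleting the neighbours of `u` separates `u` from `v`.
  2t≤i : 2 * t ≤ i
  2t≤i = ≤-trans (≤-reflexive (*-comm 2 t)) (tough-bound {t = t} G tough (adj G u) col col-adj (u ∷ v ∷ [])
    (((λ p → v≢u (sym p)) ∷ []) ∷ [] ∷ []) ((irrefl G u , col-u) ∷ (u≁v , col-v) ∷ []) ≤-refl)
    where
    col : Fin n → Fin n
    col x = if ⌊ x Fin.≟ u ⌋ then u else v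
    col-u : col u ≡ u
    col-u rewrite ≟-refl u = refl
    col-v : col v ≡ v
    col-v rewrite ≟-false v≢u = refl
    col-adj : ∀ x y → u ≁ x → u ≁ y → x ~ y → col x ≡ col y
    col-adj x y p q r with x Fin.≟ u | y Fin.≟ u
    ... | yes refl | _ = ⊥-elim (true≢false (trans (sym r) q))
    ... | no _ | yes refl = ⊥-elim (true≢false (trans (sym (~-sym r)) p))
    ... | no _ | no _ = refl

  a≤i : a ≤ i
  a≤i = count-mono {f = U} {adj G u} λ y → U⇒~ Uu

  deg≤a⇒U : ∀ {x y} → U x ≡ false → deg G x ≤ a → x ~ y → U y ≡ true
  deg≤a⇒U {x} {y} p h r = ≢false⇒true λ q → <⇒≱ (count-mono-< {f = U} {adj G x} (λ z → U⇒~ p) y q r) h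

  -- Otherwise the vertices of `L` have no neighbours outside `U`. Deleting `U` then isolates the
  -- `e` vertices of `L` and leaves `v` in yet another component, so `t * suc e ≤ a ≤ i ≤ e`.
  a<i : a < i
  a<i = ≰⇒> λ i≤a → <-irrefl refl (begin-strict
    e                              <⟨ n<1+n e ⟩
    suc e                          ≡⟨ sym (*-identityˡ (suc e)) ⟩
    1 * suc e                      ≤⟨ *-monoˡ-≤ (suc e) t≥1 ⟩
    t * suc e                      ≡⟨ cong (λ l → t * suc l) (sym (length-list L)) ⟩
    t * length (v ∷ list L)        ≤⟨ tough-bound {t = t} G tough U col (col-adj i≤a) (v ∷ list L) unique reps long ⟩
    a                              ≤⟨ a≤i ⟩
    i                              ≤⟨ i≤e ⟩
    e ∎)
    where
    open ≤-Reasoning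
    open import Data.List.Relation.Unary.Unique.Propositional.Properties using (filter⁺; allFin⁺)
    L? = λ x → L x Bool.≟ true
    inL : All (λ x → L x ≡ true) (list L)
    inL = All.all-filter L? (allFin n)
    col : Fin n → Fin n
    col x = if L x then x else v
    col-L : ∀ {x} → L x ≡ true → col x ≡ x
    col-L p rewrite p = refl
    col-v : col v ≡ v
    col-v rewrite Lv = refl
    unique : Unique (v ∷ list L)
    unique = All.map (λ p q → true≢false (trans (sym p) (trans (cong L (sym q)) Lv))) inL ∷ filter⁺ L? (allFin⁺ n)
    reps : All (λ r → U r ≡ false × col r ≡ r) (v ∷ list L)
    reps = (Uv , col-v) ∷ All.map (λ p → L⇒¬U p , col-L p) inL
    long : 2 ≤ length (v ∷ list L)
    long = s≤s (≤-trans (≤-trans t≥1 (≤-trans (m≤n*m t 2) (≤-trans 2t≤i i≤e))) (≤-reflexive (sym (length-list L))))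
    col-adj : i ≤ a → ∀ x y → U x ≡ false → U y ≡ false → x ~ y → col x ≡ col y
    col-adj h x y p q r with L x in Lx | L y in Ly
    ... | true  | _     = ⊥-elim (true≢false (trans (sym (deg≤a⇒U p (≤-trans (deg≤i x Lx) h) r)) q))
    ... | false | true  = ⊥-elim (true≢false (trans (sym (deg≤a⇒U q (≤-trans (deg≤i y Ly) h) (~-sym r))) p))
    ... | false | false = refl

  -- The vertex `v` and its non-universal neighbours; `L`, `U` and `M` partition the vertices.
  M : Fin n → Bool
  M x = not (L x) ∧ not (U x)

  deg≤D+e : ∀ x → deg G x ≤ D + e
  deg≤D+e x = +-cancelʳ-≤ 1 _ _ (≤-trans (+-monoˡ-≤ 1 (m≤m+n (deg G x) (codeg G x))) (≤-reflexive (trans (deg+codeg G x) (sym order))))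

  weight : Fin n → ℕ
  weight x = ι (L x) * i + ι (U x) * (D + e) + ι (M x) * D

  deg≤weight : ∀ x → deg G x ≤ weight x
  deg≤weight x with L x in Lx | U x in Ux
  ... | true  | _     = ≤-trans (deg≤i x Lx) (≤-trans (m≤m+n i 0) (≤-trans (m≤m+n (i + 0) _) (m≤m+n _ _)))
  ... | false | true  = ≤-trans (deg≤D+e x) (≤-trans (m≤m+n (D + e) 0) (m≤m+n _ _))
  ... | false | false = ≤-trans (deg≤D x Ux) (m≤m+n D 0)

  -- The `suc D` vertices outside `L` contribute `D` each, and every universal one a further `e`.
  weight-total : sumFin weight ≡ e * (i + a) + suc D * D
  weight-total = begin
    sumFin weight
      ≡⟨ trans (sumFin-+ (λ x → ι (L x) * i + ι (U x) * (D + e)) _) (cong (_+ sumFin (λ x → ι (M x) * D)) (sumFin-+ (λ x → ι (L x) * i) _)) ⟩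
    sumFin (λ x → ι (L x) * i) + sumFin (λ x → ι (U x) * (D + e)) + sumFin (λ x → ι (M x) * D)
      ≡⟨ cong₂ _+_ (cong₂ _+_ (scale L i) (scale U (D + e))) (scale M D) ⟩
    e * i + a * (D + e) + count M * D
      ≡⟨ arith e i a D (count M) ⟩
    e * (i + a) + (a + count M) * D
      ≡⟨ cong (λ k → e * (i + a) + k * D) a+M ⟩
    e * (i + a) + suc D * D ∎
    where
    open ≡-Reasoning
    scale : ∀ f k → sumFin {n} (λ x → ι (f x) * k) ≡ count f * k
    scale f k = trans (sumFin-* (ι ∘ f) k) (cong (_* k) (sym (count≡sum f)))
    arith : ∀ e i a D m → e * i + a * (D + e) + m * D ≡ e * (i + a) + (a + m) * D
    arith = solve-∀
    partition : ∀ x → ι (L x) + (ι (U x) + ι (M x)) ≡ 1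
    partition x with L x in Lx | U x in Ux
    ... | true  | true  = ⊥-elim (true≢false (trans (sym Ux) (L⇒¬U Lx)))
    ... | true  | false = refl
    ... | false | true  = refl
    ... | false | false = refl
    total : e + (a + count M) ≡ n
    total = begin
      e + (a + count M)
        ≡⟨ cong₂ _+_ (count≡sum L) (cong₂ _+_ (count≡sum U) (count≡sum M)) ⟩
      sumFin (ι ∘ L) + (sumFin (ι ∘ U) + sumFin (ι ∘ M))
        ≡⟨ trans (cong (sumFin (ι ∘ L) +_) (sym (sumFin-+ (ι ∘ U) (ι ∘ M)))) (sym (sumFin-+ (ι ∘ L) _)) ⟩
      sumFin (λ x → ι (L x) + (ι (U x) + ι (M x)))
        ≡⟨ sumFin-cong partition ⟩
      sumFin {n} (λ _ → 1)
        ≡⟨ trans (sumFin-const n 1) (*-identityʳ n) ⟩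
      n ∎
    a+M : a + count M ≡ suc D
    a+M = +-cancelˡ-≡ e _ _ (trans total (trans (sym order) (shuffle D e)))
      where
      shuffle : ∀ D e → D + e + 1 ≡ e + suc D
      shuffle = solve-∀

  module _ (ε : ℕ) (e≡ : e ≡ 2 * t + ε) where

    order′ : n ≡ 1 + (2 * t + ε) + D
    order′ = trans (sym order) (trans (cong (λ e → D + e + 1) e≡) (arith D (2 * t + ε)))
      where
      arith : ∀ D e → D + e + 1 ≡ 1 + e + D
      arith = solve-∀

    -- Since `n - 2t = suc (D + ε)`, twice the binomial coefficient is `suc (D + ε) * (D + ε)`; the
    -- term `suc D * D` is split off to cancel against `weight-total`.
    dense′ : ε * (ε + 2 * D + 1) + 6 * (t * t) + suc D * D ≤ Σdeg (adj G)
    dense′ = ≤-trans (≤-reflexive (begin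
      ε * (ε + 2 * D + 1) + 6 * (t * t) + suc D * D    ≡⟨ arith ε D t ⟩
      suc (D + ε) * (D + ε) + 2 * (3 * (t * t))        ≡⟨ cong (_+ 2 * (3 * (t * t))) (sym (2*nC2 (D + ε))) ⟩
      2 * (suc (D + ε) C 2) + 2 * (3 * (t * t))        ≡⟨ sym (*-distribˡ-+ 2 (suc (D + ε) C 2) _) ⟩
      2 * (suc (D + ε) C 2 + 3 * (t * t))              ≡⟨ cong (λ k → 2 * (k C 2 + 3 * (t * t))) (sym n∸2t) ⟩
      2 * ((n ∸ 2 * t) C 2 + 3 * (t * t)) ∎)) dense
      where
      open ≡-Reasoning
      arith : ∀ ε D t → ε * (ε + 2 * D + 1) + 6 * (t * t) + suc D * D ≡ suc (D + ε) * (D + ε) + 2 * (3 * (t * t))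
      arith = solve-∀
      shuffle : ∀ t ε D → 1 + (2 * t + ε) + D ≡ 2 * t + suc (D + ε)
      shuffle = solve-∀
      n∸2t : n ∸ 2 * t ≡ suc (D + ε)
      n∸2t = trans (cong (_∸ 2 * t) (trans order′ (shuffle t ε D))) (m+n∸m≡n (2 * t) _)

    star : Star t ε D i a
    star = +-cancelʳ-≤ (suc D * D) _ _ (≤-trans dense′ (≤-trans (sumFin-mono deg≤weight)
      (≤-reflexive (trans weight-total (cong (λ e → e * (i + a) + suc D * D) e≡)))))

  module _ (e≡2t : e ≡ 2 * t) where

    private
      e≡2t+0 : e ≡ 2 * t + 0
      e≡2t+0 = trans e≡2t (sym (+-identityʳ (2 * t)))

    -- Non-adjacent `z`, `z′` have degree sum below `n`, so together they miss their weight `2 * D`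
    -- by at least `D - e`. The size bound allows a total shortfall of at most `e * (i + a) - 6t²`.
    -- With `a < i ≤ e = 2t` this gives `D ≤ 2t²`, against `n-large`.
    M-clique : ∀ z z′ → M z ≡ true → M z′ ≡ true → z ≢ z′ → z ~ z′
    M-clique z z′ Mz Mz′ z≢z′ = ≢false⇒true λ q → <⇒≱ n-large (small q)
      where
      Uz : U z ≡ false
      Uz = not-true (proj₂ (∧-true {not (L z)} Mz))
      Uz′ : U z′ ≡ false
      Uz′ = not-true (proj₂ (∧-true {not (L z′)} Mz′))
      slack : Fin n → ℕ
      slack x = ι ⌊ z Fin.≟ x ⌋ * (D ∸ deg G z) + ι ⌊ z′ Fin.≟ x ⌋ * (D ∸ deg G z′)
      M⇒weight : ∀ {x} → M x ≡ true → D ≤ weight x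
      M⇒weight {x} p = ≤-trans (≤-reflexive (trans (sym (+-identityʳ D)) (cong (λ b → ι b * D) (sym p)))) (m≤n+m _ _)
      pointwise : ∀ x → deg G x + slack x ≤ weight x
      pointwise x with z Fin.≟ x | z′ Fin.≟ x
      ... | yes refl | yes refl = ⊥-elim (z≢z′ refl)
      ... | yes refl | no _ = ≤-trans (≤-reflexive (trans (cong (deg G z +_) (trans (+-identityʳ _) (+-identityʳ _))) (m+[n∸m]≡n (deg≤D z Uz)))) (M⇒weight Mz)
      ... | no _ | yes refl = ≤-trans (≤-reflexive (trans (cong (deg G z′ +_) (+-identityʳ _)) (m+[n∸m]≡n (deg≤D z′ Uz′)))) (M⇒weight Mz′)
      ... | no _ | no _ = ≤-trans (≤-reflexive (+-identityʳ _)) (deg≤weight x)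
      single : ∀ z → sumFin (λ x → ι ⌊ z Fin.≟ x ⌋ * (D ∸ deg G z)) ≡ D ∸ deg G z
      single z = trans (sumFin-* (λ x → ι ⌊ z Fin.≟ x ⌋) _)
        (trans (cong (_* (D ∸ deg G z)) (trans (sym (count≡sum (λ x → ⌊ z Fin.≟ x ⌋))) (count-≟ z))) (*-identityˡ _))
      total : Σdeg (adj G) + ((D ∸ deg G z) + (D ∸ deg G z′)) ≤ e * (i + a) + suc D * D
      total = ≤-trans (≤-reflexive (trans
          (cong (Σdeg (adj G) +_) (sym (trans (sumFin-+ (λ x → ι ⌊ z Fin.≟ x ⌋ * (D ∸ deg G z)) _) (cong₂ _+_ (single z) (single z′)))))
          (sym (sumFin-+ (deg G) slack))))
        (≤-trans (sumFin-mono pointwise) (≤-reflexive weight-total))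
      deficit : z ≁ z′ → D ≤ e + ((D ∸ deg G z) + (D ∸ deg G z′))
      deficit q = ≤-by (degree-sum z≢z′ q) (≤-reflexive (begin
          D + n                                            ≡⟨ cong (D +_) (sym order) ⟩
          D + (D + e + 1)                                  ≡⟨ cong₂ (λ p q → p + (q + e + 1)) (sym (m+[n∸m]≡n (deg≤D z Uz))) (sym (m+[n∸m]≡n (deg≤D z′ Uz′))) ⟩
          (d + s) + (d′ + s′ + e + 1)                      ≡⟨ arith d s d′ s′ e ⟩
          e + (s + s′) + suc (d + d′) ∎))
        where
        open ≡-Reasoning
        d = deg G z
        d′ = deg G z′
        s = D ∸ d
        s′ = D ∸ d′
        arith : ∀ d s d′ s′ e → (d + s) + (d′ + s′ + e + 1) ≡ e + (s + s′) + suc (d + d′)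
        arith = solve-∀
      small : z ≁ z′ → n ≤ 2 * (t * t) + 2 * t + 1
      small q = begin
        n                          ≡⟨ trans (order′ 0 e≡2t+0) (shuffle t D) ⟩
        D + 2 * t + 1              ≤⟨ +-monoˡ-≤ 1 (+-monoˡ-≤ (2 * t) D≤) ⟩
        2 * (t * t) + 2 * t + 1 ∎
        where
        open ≤-Reasoning
        shuffle : ∀ t D → 1 + (2 * t + 0) + D ≡ D + 2 * t + 1
        shuffle = solve-∀
        i+a<4t : suc (i + a) ≤ 2 * t + 2 * t
        i+a<4t = ≤-trans (≤-reflexive (sym (+-suc i a))) (+-mono-≤ i≤2t (≤-trans a<i i≤2t))
          where
          i≤2t : i ≤ 2 * t
          i≤2t = ≤-trans i≤e (≤-reflexive e≡2t)
        expand : ∀ t → 2 * t * (2 * t + 2 * t) ≡ 2 * (t * t) + 6 * (t * t)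
        expand = solve-∀
        s = (D ∸ deg G z) + (D ∸ deg G z′)
        step : 6 * (t * t) + s ≤ e * (i + a)
        step = +-cancelʳ-≤ (suc D * D) _ _ (≤-trans (≤-reflexive (swap (6 * (t * t)) s (suc D * D)))
                 (≤-trans (+-monoˡ-≤ s (dense′ 0 e≡2t+0)) total))
          where
          swap : ∀ x s y → x + s + y ≡ x + y + s
          swap = solve-∀
        D≤ : D ≤ 2 * (t * t)
        D≤ = +-cancelʳ-≤ (6 * (t * t)) _ _ (begin
          D + 6 * (t * t)           ≤⟨ +-monoˡ-≤ _ (deficit q) ⟩
          e + s + 6 * (t * t)       ≡⟨ trans (+-assoc e s _) (cong (e +_) (+-comm s _)) ⟩
          e + (6 * (t * t) + s)     ≤⟨ +-monoʳ-≤ e step ⟩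
          e + e * (i + a)           ≡⟨ sym (*-suc e (i + a)) ⟩
          e * suc (i + a)           ≤⟨ *-monoʳ-≤ e i+a<4t ⟩
          e * (2 * t + 2 * t)       ≡⟨ trans (cong (_* (2 * t + 2 * t)) e≡2t) (expand t) ⟩
          2 * (t * t) + 6 * (t * t) ∎)

    -- By maximality of `D`, `z` has at least `e` non-neighbours. As `M` is a clique, they all lie
    -- in `L`, which has only `e` elements.
    M-L-nonadjacent : ∀ {z w} → L z ≡ false → U z ≡ false → L w ≡ true → z ≁ w
    M-L-nonadjacent {z} {w} Lz Uz Lw = ≢true⇒false λ zw → <⇒≱ (codeg< zw) e≤
      where
      inL : z ~ w → ∀ x → coadj G z x ≡ true → L x ≡ true
      inL zw x p = ≢false⇒true λ Lx → true≢false (trans (sym (M-clique z x (∧-intro (cong not Lz) (cong not Uz))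
        (∧-intro (cong not Lx) (cong not (nonuniversal (coadj-sym G p)))) (proj₂ (coadj-true G p)))) (proj₁ (coadj-true G p)))
      codeg< : z ~ w → codeg G z < e
      codeg< zw = count-mono-< {f = coadj G z} {L} (inL zw) w (≢true⇒false λ p → true≢false (trans (sym zw) (proj₁ (coadj-true G p)))) Lw
      e≤ : e ≤ codeg G z
      e≤ = ≤-by (deg≤D z Uz) (≤-reflexive (suc-injective (trans (shuffle e D) (trans order (trans (sym (deg+codeg G z)) (shuffle′ (deg G z) (codeg G z)))))))
        where
        shuffle : ∀ e D → suc (e + D) ≡ D + e + 1
        shuffle = solve-∀
        shuffle′ : ∀ d c → d + c + 1 ≡ suc (c + d)
        shuffle′ = solve-∀

    -- Deleting `U` separates `u` in `L` from `v` in `M`, so `2t ≤ a`, although `a < i ≤ e = 2t`.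
    e≢2t : ⊥
    e≢2t = <⇒≱ a<i (≤-trans i≤e (≤-trans (≤-reflexive (trans e≡2t (*-comm 2 t)))
      (tough-bound {t = t} G tough U col col-adj (u ∷ v ∷ []) (((λ p → v≢u (sym p)) ∷ []) ∷ [] ∷ [])
        ((Uu , col-u) ∷ (Uv , col-v) ∷ []) ≤-refl)))
      where
      col : Fin n → Fin n
      col x = if L x then u else v
      col-u : col u ≡ u
      col-u rewrite Lu = refl
      col-v : col v ≡ v
      col-v rewrite Lv = refl
      col-adj : ∀ x y → U x ≡ false → U y ≡ false → x ~ y → col x ≡ col y
      col-adj x y p q r with L x in Lx | L y in Ly
      ... | true  | true  = refl
      ... | true  | false = ⊥-elim (true≢false (trans (sym (~-sym r)) (M-L-nonadjacent Ly q Lx)))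
      ... | false | true  = ⊥-elim (true≢false (trans (sym r) (M-L-nonadjacent Lx p Ly)))
      ... | false | false = refl

  I-exists : ∃ λ I → length I ≡ suc a × Unique I × AllPairs _≁_ I × (∀ {x} → x ∈ I → U x ≡ false)
  I-exists with path u v (λ p → v≢u (sym p)) u≁v
  ... | xs , walk , perm with unique-allFin perm | successors-independent G U universal ¬ham xs walk perm Uv
  ...   | p ∷ ps | independent = I ,
    cong suc (trans (length-successors {r = adj G} U u xs walk Uv) (cnt-allFin U perm)) ,
    successors-All {r = adj G} U u xs p ∷ successors-unique {r = adj G} U u xs ps ,
    independent , nonuniv independent
    where
    I : List (Fin n)
    I = u ∷ successors {r = adj G} U u xs
    -- A universal member other than `u` would be adjacent to `u`.
    nonuniv : AllPairs _≁_ I → ∀ {x} → x ∈ I → U x ≡ false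
    nonuniv _ (here refl) = Uu
    nonuniv (h ∷ _) {x} (there q) = ≢true⇒false λ Ux → case x Fin.≟ u of λ
      { (yes refl) → true≢false (trans (sym Ux) Uu)
      ; (no x≢u) → true≢false (trans (sym (~-sym (universal x u Ux x≢u))) (All.lookup h q)) }

  impossible : ⊥
  impossible with m≤n⇒m<n∨m≡n (≤-trans 2t≤i i≤e)
  ... | inj₂ 2t≡e = e≢2t (sym 2t≡e)
  ... | inj₁ 2t<e with m≤n⇒∃[o]m+o≡n 2t<e
  ... | ε , p = refute I-exists (conclusion ε D i a (≤-trans n≥n₀ (≤-reflexive n≡)) i≤D
                     (≤-trans i≤e (≤-reflexive e≡)) a<i (star (suc ε) e≡))
    where
    e≡ : e ≡ 2 * t + suc ε
    e≡ = trans (sym p) (sym (+-suc (2 * t) ε))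
    n≡ : n ≡ 1 + (2 * t + suc ε) + D
    n≡ = order′ (suc ε) e≡
    1+t≤n : suc t ≤ n
    1+t≤n = ≤-trans (s≤s (≤-trans (m≤m+n t _) (≤-trans (m≤n+m (2 * t) (2 * (t * t))) (m≤m+n _ 1)))) n-large
    refute : (∃ λ I → length I ≡ suc a × Unique I × AllPairs _≁_ I × (∀ {x} → x ∈ I → U x ≡ false)) →
      1 + (2 * t + suc ε) + D < suc t * suc a ⊎ D ≤ suc a → ⊥
    refute (I , l , uI , iI , _) (inj₁ h) = <⇒≱ (≤-<-trans (≤-reflexive n≡) h)
      (≤-trans (≤-reflexive (cong (suc t *_) (sym l))) (tough-independent {t = t} G tough I uI iI (≤-trans (s≤s a≥1) (≤-reflexive (sym l)))))
      where
      -- `I` needs two members for its complement to be a cutset; `a = 0` would give `n < suc t`.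
      a≥1 : 1 ≤ a
      a≥1 = ≰⇒> λ a≤0 → <⇒≱ (≤-<-trans (≤-reflexive n≡) h)
        (≤-trans (*-monoʳ-≤ (suc t) (s≤s a≤0)) (≤-trans (≤-reflexive (*-identityʳ (suc t))) 1+t≤n))
    refute (I , l , uI , iI , I∩U) (inj₂ h) = <⇒≱ (n<1+n a)
      (≤-trans (≤-trans (≤-reflexive (trans (sym (*-identityˡ (suc a))) (cong (1 *_) (sym l)))) (*-monoˡ-≤ (length I) t≥1))
        (separated {t = t} G tough I uI iI (≤-trans (s≤s a≥1) (≤-reflexive (sym l))) u I∩U (λ x Ux → ≤-trans (deg≤D x Ux) h)))
      where
      -- Here two members of `I` are ensured by `2 ≤ 2t ≤ i ≤ D ≤ suc a`.
      a≥1 : 1 ≤ a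
      a≥1 = ≤-pred (≤-trans (≤-trans (*-monoʳ-≤ 2 t≥1) (≤-trans 2t≤i i≤D)) h)

-- Passing to an edge-maximal graph

addEdge-⊇ : ∀ {n} (G : Graph n) {u v : Fin n} (u≢v : u ≢ v) x y → adj G x y ≡ true → adj (addEdge G u≢v) x y ≡ true
addEdge-⊇ G u≢v x y p = ∨-introˡ p

reach-mono : ∀ {n} {G H : Graph n} → (∀ x y → adj G x y ≡ true → adj H x y ≡ true) →
  ∀ S k x y → reachB G S k x y ≡ true → reachB H S k x y ≡ true
reach-mono h S zero    x y p = p
reach-mono h S (suc k) x y p with ∨-true p
... | inj₁ q = ∨-introˡ (reach-mono h S k x y q)
... | inj₂ q with ∧-true q
...   | a , b with anyFin-true b
...     | w , c with ∧-true c
...       | d , e = ∨-introʳ (∧-intro a (anyFin-intro w (∧-intro (reach-mono h S k x w d) (h w y e))))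

-- Additional edges can only merge components: a vertex that is least in its component of `H - S` is
-- also least in its component of `G - S`.
tough-mono : ∀ {n t} {G H : Graph n} → (∀ x y → adj G x y ≡ true → adj H x y ≡ true) → Tough t G → Tough t H
tough-mono {n} {t} {G} {H} h tough S c≥2 = ≤-trans (*-monoʳ-≤ t fewer) (tough S (≤-trans c≥2 fewer))
  where
  fewer : components H S ≤ components G S
  fewer = count-mono λ v p → let a , b = ∧-true p in
    ∧-intro a (cong not (≢true⇒false λ q → let u , c = anyFin-true q ; d , e = ∧-true c in
      true≢false (trans (sym (anyFin-intro u (∧-intro d (reach-mono {G = G} {H} h S n u v e)))) (not-true b))))

-- Induction on a bound for `n * n` minus the degree sum. If `G` is not Hamiltonian, the induction
-- hypothesis makes every `G + uv` Hamiltonian, which supplies the paths that `Core` demands.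
hamiltonian : ∀ {t n n₀} → 1 ≤ t → n₀ ≤ n → 2 * (t * t) + 2 * t + 1 < n → StarConclusion t n₀ →
  (G : Graph n) → Tough t G → 2 * ((n ∸ 2 * t) C 2 + 3 * (t * t)) ≤ Σdeg (adj G) → Ham (adj G)
hamiltonian {t} {n} {n₀} t≥1 n≥n₀ n-large conclusion G₀ tough₀ dense₀ = go (n * n) G₀ (m≤m+n (n * n) _) tough₀ dense₀
  where
  Σdeg<n² : (G : Graph n) → Σdeg (adj G) < n * n
  Σdeg<n² G = ≤-trans (sumFin-mono-< {g = λ _ → n} (λ x → <⇒≤ (deg<n x)) (Fin.fromℕ< n>0) (deg<n _)) (≤-reflexive (sumFin-const n n))
    where
    n>0 : 0 < n
    n>0 = ≤-<-trans z≤n n-large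
    deg<n : ∀ x → deg G x < n
    deg<n x = ≤-trans (s≤s (m≤m+n (deg G x) (codeg G x))) (≤-reflexive (trans (+-comm 1 _) (deg+codeg G x)))

  go : ∀ k (G : Graph n) → n * n ≤ k + Σdeg (adj G) → Tough t G → 2 * ((n ∸ 2 * t) C 2 + 3 * (t * t)) ≤ Σdeg (adj G) → Ham (adj G)
  -- All degrees are below `n`, so the degree sum cannot reach `n * n`.
  go zero    G fuel _ _ = ⊥-elim (<⇒≱ (Σdeg<n² G) fuel)
  go (suc k) G fuel tough dense with ham? (adj G)
  ... | yes h = h
  ... | no ¬h = ⊥-elim contradictory
    where
    open Universal G
    n≥3 : 3 ≤ n
    n≥3 = ≤-trans (s≤s (+-monoˡ-≤ 1 {1} (≤-trans (≤-trans t≥1 (m≤n*m t 2)) (m≤n+m (2 * t) (2 * (t * t)))))) n-large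
    contradictory : ⊥
    contradictory with some-nonuniversal n≥3 ¬h
    ... | x , Ux with argmax (not ∘ U) (deg G) x (cong not Ux)
    ...   | v , Uv , v-max with nonneighbour (not-true Uv)
    ...     | y , vy with argmax (coadj G v) (deg G) y vy
    ...       | u , Lu , u-max = Core.impossible t≥1 n≥n₀ n-large conclusion G tough dense path ¬h
      v (not-true Uv) (λ x p → v-max x (cong not p)) u Lu u-max
      where
      path : ∀ u v → u ≢ v → adj G u v ≡ false → HamPath G u v
      path u v u≢v u≁v = addEdge-hamPath G u≢v n≥3 ¬h (go k G′
          (≤-pred (≤-trans (s≤s fuel) (≤-trans (≤-reflexive (sym (+-suc (suc k) _))) (+-monoʳ-≤ (suc k) more))))
          (tough-mono {t = t} {G = G} {G′} (addEdge-⊇ G u≢v) tough) (≤-trans dense (<⇒≤ more)))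
        where
        G′ : Graph n
        G′ = addEdge G u≢v
        uv : adj G′ u v ≡ true
        uv = ∨-introʳ {adj G u v} (∨-introˡ (∧-intro (≟-refl u) (≟-refl v)))
        more : Σdeg (adj G) < Σdeg (adj G′)
        more = sumFin-mono-< (λ x → count-mono (addEdge-⊇ G u≢v x)) u (count-mono-< {f = adj G u} {adj G′ u} (addEdge-⊇ G u≢v u) v u≁v uv)

-- Pancyclicity from the size bound

pancyclic : ∀ {t n n₀} → 1 ≤ t → n₀ ≤ n → 2 * (t * t) + 2 * t + 1 < n → 4 * t + 3 ≤ n → StarConclusion t n₀ →
  (G : Graph n) → Tough t G → (n ∸ 2 * t) C 2 + 3 * (t * t) ≤ size G → Pancyclic G
pancyclic {suc s} {n} t≥1 n≥n₀ n-large n≥4t+3 conclusion G tough large =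
  bondy G (hamiltonian {t = t} t≥1 n≥n₀ n-large conclusion G tough dense) (≤-trans edges (*-monoʳ-≤ 2 dense))
  where
  t = suc s
  dense : 2 * ((n ∸ 2 * t) C 2 + 3 * (t * t)) ≤ Σdeg (adj G)
  dense = ≤-trans (*-monoʳ-≤ 2 large) (≤-reflexive (sym (Σdeg≡2size G)))
  edges : n * n < 2 * (2 * ((n ∸ 2 * t) C 2 + 3 * (t * t)))
  edges with m≤n⇒∃[o]m+o≡n n≥4t+3
  ... | r , p = begin-strict
    n * n                                            ≡⟨ cong (λ m → m * m) (sym p) ⟩
    (4 * t + 3 + r) * (4 * t + 3 + r)                <⟨ ≤-trans (m≤m+n _ _) (≤-reflexive (identity s r)) ⟩
    2 * (suc k * k + 2 * (3 * (t * t)))              ≡⟨ cong (λ m → 2 * (m + 2 * (3 * (t * t)))) (sym (2*nC2 k)) ⟩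
    2 * (2 * (suc k C 2) + 2 * (3 * (t * t)))        ≡⟨ cong (2 *_) (sym (*-distribˡ-+ 2 (suc k C 2) _)) ⟩
    2 * (2 * (suc k C 2 + 3 * (t * t)))              ≡⟨ cong (λ m → 2 * (2 * (m C 2 + 3 * (t * t)))) (sym n∸2t) ⟩
    2 * (2 * ((n ∸ 2 * t) C 2 + 3 * (t * t))) ∎
    where
    open ≤-Reasoning
    k = 2 * t + 2 + r
    shuffle : ∀ t r → 4 * t + 3 + r ≡ 2 * t + suc (2 * t + 2 + r)
    shuffle = solve-∀
    n∸2t : n ∸ 2 * t ≡ suc k
    n∸2t = trans (cong (_∸ 2 * t) (trans (sym p) (shuffle t r))) (m+n∸m≡n (2 * t) (suc k))
    -- For `n = 4t + 3 + r` the two sides of `edges` differ by `r² + 4r + 3 + 4t(t - 1)`; writing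
    -- `t = suc s` avoids subtraction.
    identity : ∀ s r → suc ((4 * suc s + 3 + r) * (4 * suc s + 3 + r)) + (r * r + 4 * r + 2 + 4 * (suc s * s)) ≡
      2 * (suc (2 * suc s + 2 + r) * (2 * suc s + 2 + r) + 2 * (3 * (suc s * suc s)))
    identity = solve-∀

theorem2p1 : (t n : ℕ) (G : Graph n) →
    ((t ≡ 1 × 7 ≤ n) ⊎ (t ≡ 2 × 16 ≤ n) ⊎ (t ≡ 3 × 28 ≤ n)) →
    Connected G → Tough t G →
    ((n ∸ 2 * t) C 2) + 3 * (t * t) ≤ size G →
    Pancyclic G ⊎ Bipartite G
theorem2p1 t n G (inj₁ (refl , n≥7)) _ tough large =
  -- For `t = 1, 2, 3` the bounds `2t² + 2t + 2` and `4t + 3` on `n` are 6 and 7, 14 and 11, 26 and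
  -- 15.
  inj₁ (pancyclic {t = 1} (s≤s z≤n) n≥7 (≤-trans (m≤m+n 6 1) n≥7) n≥7 star₁ G tough large)
theorem2p1 t n G (inj₂ (inj₁ (refl , n≥16))) _ tough large =
  inj₁ (pancyclic {t = 2} (s≤s z≤n) n≥16 (≤-trans (m≤m+n 14 2) n≥16) (≤-trans (m≤m+n 11 5) n≥16) star₂ G tough large)
theorem2p1 t n G (inj₂ (inj₂ (refl , n≥28))) _ tough large =
  inj₁ (pancyclic {t = 3} (s≤s z≤n) n≥28 (≤-trans (m≤m+n 26 2) n≥28) (≤-trans (m≤m+n 15 13) n≥28) star₃ G tough large)
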